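{- For every integer $k\ge 4$ there are infinitely many (pairwise non-isomorphic) connected signed $k$-regular graphs whose distinct eigenvalues are exactly $\sqrt{k}$ and $-\sqrt{k}$.
   Context: A signed graph is a finite simple graph (the ground graph) together with a sign function $\sigma$ on its edges with values in $\{1,-1\}$. It is connected, respectively $k$-regular, if its ground graph is. Its eigenvalues are those of its adjacency matrix, whose $(i,j)$ entry is $\sigma(v_iv_j)$ if $v_i,v_j$ are adjacent and $0$ otherwise. Two signed graphs are isomorphic if there is an isomorphism of the ground graphs preserving the signs of edges. -}

module Defs where

open import Data.Bool.Base using (Bool; false; T)
open import Data.Bool.Properties using (T?)
open import Data.Fin.Base using (Fin)
open import Data.Fin.Subset using (∣_∣)
open import Data.Integer.Base as ℤ using (ℤ; +_; 0ℤ; _◃_)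
import Data.Integer.Properties as ℤ
open import Data.Nat.Base as ℕ using (ℕ; zero; suc)
import Data.Nat.Properties as ℕ
open import Data.Nat.Tactic.RingSolver using (solve-∀)
open import Data.Product.Base using (_×_; _,_; ∃; ∃-syntax; proj₁; proj₂)
open import Data.Rational.Base as ℚ using (ℚ; 0ℚ; 1ℚ; mkℚ; *<*)
import Data.Rational.Properties as ℚ
open import Data.Rational.Solver using (module +-*-Solver)
open import Data.Rational.Unnormalised.Base as ℚᵘ using (mkℚᵘ)
import Data.Rational.Unnormalised.Properties as ℚᵘ
open import Data.Sign.Base using (Sign)
open import Data.Sum.Base using (_⊎_; inj₁; inj₂)
open import Data.Vec.Base using (tabulate)
open import Data.Vec.Functional using (Vector; foldr)
open import Function.Bundles using (_↔_; Inverse; _⇔_)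
open import Relation.Binary.Construct.Closure.ReflexiveTransitive using (Star)
open import Relation.Binary.PropositionalEquality
open import Relation.Nullary.Decidable using (Dec; yes; no)
open import Relation.Nullary.Negation using (¬_)

-- Real numbers are rational Cauchy sequences, considered up to _≈_.

Cauchy : (ℕ → ℚ) → Set
Cauchy s = ∀ ε → 0ℚ ℚ.< ε →
           ∃[ N ] (∀ m n → N ℕ.≤ m → N ℕ.≤ n → ℚ.∣ s m ℚ.- s n ∣ ℚ.< ε)

record ℝ : Set where
  constructor mkℝ
  field
    seq    : ℕ → ℚ
    cauchy : Cauchy seq

open ℝ public

infix 4 _≈_ _#_

_≈_ : ℝ → ℝ → Set
x ≈ y = ∀ ε → 0ℚ ℚ.< ε →
        ∃[ N ] (∀ n → N ℕ.≤ n → ℚ.∣ seq x n ℚ.- seq y n ∣ ℚ.< ε)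

-- Apartness, the positive form of being distinct; classically x # y
-- holds exactly when x ≈ y fails.
_#_ : ℝ → ℝ → Set
x # y = ∃[ ε ] (0ℚ ℚ.< ε × ∃[ N ] (∀ n → N ℕ.≤ n → ε ℚ.< ℚ.∣ seq x n ℚ.- seq y n ∣))

private
  abstract
    ∣+-+∣< : ∀ a b c d {ε δ} → ℚ.∣ a ℚ.- c ∣ ℚ.< ε → ℚ.∣ b ℚ.- d ∣ ℚ.< δ →
             ℚ.∣ (a ℚ.+ b) ℚ.- (c ℚ.+ d) ∣ ℚ.< ε ℚ.+ δ
    ∣+-+∣< a b c d {ε} {δ} p q = begin-strict
      ℚ.∣ (a ℚ.+ b) ℚ.- (c ℚ.+ d) ∣
        ≡⟨ cong ℚ.∣_∣ (rearrange a b c d) ⟩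
      ℚ.∣ (a ℚ.- c) ℚ.+ (b ℚ.- d) ∣
        ≤⟨ ℚ.∣p+q∣≤∣p∣+∣q∣ (a ℚ.- c) (b ℚ.- d) ⟩
      ℚ.∣ a ℚ.- c ∣ ℚ.+ ℚ.∣ b ℚ.- d ∣
        <⟨ ℚ.+-mono-< p q ⟩
      ε ℚ.+ δ ∎
      where
      open ℚ.≤-Reasoning
      rearrange : ∀ a b c d → (a ℚ.+ b) ℚ.- (c ℚ.+ d) ≡ (a ℚ.- c) ℚ.+ (b ℚ.- d)
      rearrange = solve 4 (λ a b c d → (a :+ b) :- (c :+ d) := (a :- c) :+ (b :- d)) refl
        where open +-*-Solver

    ∣neg∣< : ∀ a b {ε} → ℚ.∣ a ℚ.- b ∣ ℚ.< ε → ℚ.∣ (ℚ.- a) ℚ.- (ℚ.- b) ∣ ℚ.< ε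
    ∣neg∣< a b {ε} = subst (ℚ._< ε)
      (trans (sym (ℚ.∣-p∣≡∣p∣ (a ℚ.- b))) (cong ℚ.∣_∣ (ℚ.neg-distrib-+ a (ℚ.- b))))

    ∣∣<+ : ∀ a c {ε} → ℚ.∣ a ℚ.- c ∣ ℚ.< ε → ℚ.∣ a ∣ ℚ.< ε ℚ.+ ℚ.∣ c ∣
    ∣∣<+ a c {ε} p = begin-strict
      ℚ.∣ a ∣                      ≡⟨ cong ℚ.∣_∣ (rearrange a c) ⟩
      ℚ.∣ (a ℚ.- c) ℚ.+ c ∣        ≤⟨ ℚ.∣p+q∣≤∣p∣+∣q∣ (a ℚ.- c) c ⟩
      ℚ.∣ a ℚ.- c ∣ ℚ.+ ℚ.∣ c ∣    <⟨ ℚ.+-monoˡ-< ℚ.∣ c ∣ p ⟩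
      ε ℚ.+ ℚ.∣ c ∣                ∎
      where
      open ℚ.≤-Reasoning
      rearrange : ∀ a b → a ≡ (a ℚ.- b) ℚ.+ b
      rearrange = solve 2 (λ a b → a := (a :- b) :+ b) refl
        where open +-*-Solver

    ∣*-*∣< : ∀ a b c d {B C δ} → 0ℚ ℚ.< δ →
             ℚ.∣ a ∣ ℚ.< B → ℚ.∣ d ∣ ℚ.< C →
             ℚ.∣ a ℚ.- c ∣ ℚ.< δ → ℚ.∣ b ℚ.- d ∣ ℚ.< δ →
             ℚ.∣ (a ℚ.* b) ℚ.- (c ℚ.* d) ∣ ℚ.< (B ℚ.+ C) ℚ.* δ
    ∣*-*∣< a b c d {B} {C} {δ} 0<δ a<B d<C p q = begin-strict
      ℚ.∣ (a ℚ.* b) ℚ.- (c ℚ.* d) ∣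
        ≡⟨ cong ℚ.∣_∣ (rearrange a b c d) ⟩
      ℚ.∣ a ℚ.* (b ℚ.- d) ℚ.+ d ℚ.* (a ℚ.- c) ∣
        ≤⟨ ℚ.∣p+q∣≤∣p∣+∣q∣ (a ℚ.* (b ℚ.- d)) (d ℚ.* (a ℚ.- c)) ⟩
      ℚ.∣ a ℚ.* (b ℚ.- d) ∣ ℚ.+ ℚ.∣ d ℚ.* (a ℚ.- c) ∣
        ≤⟨ ℚ.+-mono-≤ (scaled a (b ℚ.- d) q) (scaled d (a ℚ.- c) p) ⟩
      ℚ.∣ a ∣ ℚ.* δ ℚ.+ ℚ.∣ d ∣ ℚ.* δ
        ≡⟨ ℚ.*-distribʳ-+ δ ℚ.∣ a ∣ ℚ.∣ d ∣ ⟨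
      (ℚ.∣ a ∣ ℚ.+ ℚ.∣ d ∣) ℚ.* δ
        <⟨ ℚ.*-monoˡ-<-pos δ {{ℚ.positive 0<δ}} (ℚ.+-mono-< a<B d<C) ⟩
      (B ℚ.+ C) ℚ.* δ ∎
      where
      open ℚ.≤-Reasoning
      rearrange : ∀ a b c d →
        (a ℚ.* b) ℚ.- (c ℚ.* d) ≡ a ℚ.* (b ℚ.- d) ℚ.+ d ℚ.* (a ℚ.- c)
      rearrange = solve 4 (λ a b c d →
          (a :* b) :- (c :* d) := a :* (b :- d) :+ d :* (a :- c)) refl
        where open +-*-Solver
      scaled : ∀ u v → ℚ.∣ v ∣ ℚ.< δ → ℚ.∣ u ℚ.* v ∣ ℚ.≤ ℚ.∣ u ∣ ℚ.* δ
      scaled u v v<δ = begin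
        ℚ.∣ u ℚ.* v ∣          ≡⟨ ℚ.∣p*q∣≡∣p∣*∣q∣ u v ⟩
        ℚ.∣ u ∣ ℚ.* ℚ.∣ v ∣    ≤⟨ ℚ.*-monoˡ-≤-nonNeg ℚ.∣ u ∣ {{ℚ.∣-∣-nonNeg u}} (ℚ.<⇒≤ v<δ) ⟩
        ℚ.∣ u ∣ ℚ.* δ          ∎

    split : ∀ ε → 0ℚ ℚ.< ε → ∃[ δ ] (0ℚ ℚ.< δ × δ ℚ.+ δ ≡ ε)
    split ε 0<ε =
      ℚ.½ ℚ.* ε ,
      ℚ.positive⁻¹ _ {{ℚ.pos*pos⇒pos ℚ.½ ε {{ℚ.positive 0<ε}}}} ,
      trans (sym (ℚ.*-distribʳ-+ ε ℚ.½ ℚ.½)) (ℚ.*-identityˡ ε)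

    divide : ∀ D ε → 0ℚ ℚ.< D → 0ℚ ℚ.< ε → ∃[ δ ] (0ℚ ℚ.< δ × D ℚ.* δ ≡ ε)
    divide D ε 0<D 0<ε =
      (ℚ.1/ D) ℚ.* ε ,
      ℚ.positive⁻¹ _ {{ℚ.pos*pos⇒pos (ℚ.1/ D) {{ℚ.1/pos⇒pos D}} ε {{ℚ.positive 0<ε}}}} ,
      trans (sym (ℚ.*-assoc D (ℚ.1/ D) ε))
            (trans (cong (ℚ._* ε) (ℚ.*-inverseʳ D)) (ℚ.*-identityˡ ε))
      where
      instance
        D-pos : ℚ.Positive D
        D-pos = ℚ.positive 0<D
        D-nonZero : ℚ.NonZero D
        D-nonZero = ℚ.pos⇒nonZero D

    0<1 : 0ℚ ℚ.< 1ℚ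
    0<1 = ℚ.positive⁻¹ 1ℚ

    0<e+∣∣ : ∀ e c → 0ℚ ℚ.< e → 0ℚ ℚ.< e ℚ.+ ℚ.∣ c ∣
    0<e+∣∣ e c 0<e = ℚ.+-mono-<-≤ {0ℚ} {e} {0ℚ} {ℚ.∣ c ∣} 0<e (ℚ.0≤∣p∣ c)

    0<+ : ∀ {B C} → 0ℚ ℚ.< B → 0ℚ ℚ.< C → 0ℚ ℚ.< B ℚ.+ C
    0<+ {B} {C} p q = ℚ.+-mono-< {0ℚ} {B} {0ℚ} {C} p q

    const-cauchy : ∀ q → Cauchy (λ _ → q)
    const-cauchy q ε 0<ε =
      0 , λ _ _ _ _ → subst (λ r → ℚ.∣ r ∣ ℚ.< ε) (sym (ℚ.+-inverseʳ q)) 0<ε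

    +-cauchy : ∀ x y → Cauchy (λ n → seq x n ℚ.+ seq y n)
    +-cauchy x y ε 0<ε with split ε 0<ε
    ... | δ , 0<δ , refl with cauchy x δ 0<δ | cauchy y δ 0<δ
    ... | M , p | N , q = M ℕ.⊔ N , λ m n m≥ n≥ →
      ∣+-+∣< (seq x m) (seq y m) (seq x n) (seq y n)
        (p m n (ℕ.m⊔n≤o⇒m≤o M N m≥) (ℕ.m⊔n≤o⇒m≤o M N n≥))
        (q m n (ℕ.m⊔n≤o⇒n≤o M N m≥) (ℕ.m⊔n≤o⇒n≤o M N n≥))

    neg-cauchy : ∀ x → Cauchy (λ n → ℚ.- seq x n)
    neg-cauchy x ε 0<ε with cauchy x ε 0<ε
    ... | N , p = N , λ m n m≥ n≥ → ∣neg∣< (seq x m) (seq x n) (p m n m≥ n≥)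

    bounded : ∀ x → ∃[ B ] (0ℚ ℚ.< B × ∃[ N ] (∀ n → N ℕ.≤ n → ℚ.∣ seq x n ∣ ℚ.< B))
    bounded x with 1ℚ | 0<1
    ... | e | 0<e with cauchy x e 0<e
    ... | N , p =
      e ℚ.+ ℚ.∣ seq x N ∣ , 0<e+∣∣ e (seq x N) 0<e ,
      N , λ n n≥ → ∣∣<+ (seq x n) (seq x N) (p n N n≥ ℕ.≤-refl)

    *-cauchy : ∀ x y → Cauchy (λ n → seq x n ℚ.* seq y n)
    *-cauchy x y ε 0<ε =
      let B , 0<B , K , b = bounded x
          C , 0<C , L , c = bounded y
          δ , 0<δ , Dδ≡ε  = divide (B ℚ.+ C) ε (0<+ 0<B 0<C) 0<ε
          M , p           = cauchy x δ 0<δ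
          N , q           = cauchy y δ 0<δ
      in (K ℕ.⊔ L) ℕ.⊔ (M ℕ.⊔ N) , λ m n m≥ n≥ →
      let m≥KL = ℕ.m⊔n≤o⇒m≤o (K ℕ.⊔ L) (M ℕ.⊔ N) m≥
          n≥KL = ℕ.m⊔n≤o⇒m≤o (K ℕ.⊔ L) (M ℕ.⊔ N) n≥
          m≥MN = ℕ.m⊔n≤o⇒n≤o (K ℕ.⊔ L) (M ℕ.⊔ N) m≥
          n≥MN = ℕ.m⊔n≤o⇒n≤o (K ℕ.⊔ L) (M ℕ.⊔ N) n≥
      in subst (ℚ.∣ (seq x m ℚ.* seq y m) ℚ.- (seq x n ℚ.* seq y n) ∣ ℚ.<_) Dδ≡ε
         (∣*-*∣< (seq x m) (seq y m) (seq x n) (seq y n) 0<δ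
           (b m (ℕ.m⊔n≤o⇒m≤o K L m≥KL))
           (c n (ℕ.m⊔n≤o⇒n≤o K L n≥KL))
           (p m n (ℕ.m⊔n≤o⇒m≤o M N m≥MN) (ℕ.m⊔n≤o⇒m≤o M N n≥MN))
           (q m n (ℕ.m⊔n≤o⇒n≤o M N m≥MN) (ℕ.m⊔n≤o⇒n≤o M N n≥MN)))

infixl 6 _+_
infixl 7 _*_
infix  8 -_

fromℚ : ℚ → ℝ
fromℚ q = mkℝ (λ _ → q) (const-cauchy q)

fromℤ : ℤ → ℝ
fromℤ z = fromℚ (z ℚ./ 1)

0ℝ : ℝ
0ℝ = fromℚ 0ℚ

_+_ : ℝ → ℝ → ℝ
x + y = mkℝ (λ n → seq x n ℚ.+ seq y n) (+-cauchy x y)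

_*_ : ℝ → ℝ → ℝ
x * y = mkℝ (λ n → seq x n ℚ.* seq y n) (*-cauchy x y)

-_ : ℝ → ℝ
- x = mkℝ (λ n → ℚ.- seq x n) (neg-cauchy x)

-- The nonnegative square root of a natural number, as the limit of
-- ⌊√(k N²)⌋ / N for N = 1, 2, 3, …

isqrtFrom : (n r : ℕ) → Dec (suc r ℕ.* suc r ℕ.≤ n) → ℕ
isqrtFrom n r (yes _) = suc r
isqrtFrom n r (no  _) = r

isqrt : ℕ → ℕ
isqrt zero    = 0
isqrt (suc n) = isqrtFrom (suc n) (isqrt n) (suc (isqrt n) ℕ.* suc (isqrt n) ℕ.≤? suc n)

isqrt-spec : ∀ n → isqrt n ℕ.* isqrt n ℕ.≤ n × n ℕ.< suc (isqrt n) ℕ.* suc (isqrt n)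
isqrt-spec zero = ℕ.z≤n , ℕ.s≤s ℕ.z≤n
isqrt-spec (suc n)
  with isqrt n | isqrt-spec n | suc (isqrt n) ℕ.* suc (isqrt n) ℕ.≤? suc n
... | r | lo , hi | yes p =
  p , ℕ.≤-<-trans hi (ℕ.*-mono-< (ℕ.n<1+n (suc r)) (ℕ.n<1+n (suc r)))
... | r | lo , hi | no ¬p = ℕ.m≤n⇒m≤1+n lo , ℕ.≰⇒> ¬p

√-seq : ℕ → ℕ → ℚ
√-seq k n = (+ isqrt (k ℕ.* (suc n ℕ.* suc n))) ℚ./ suc n

private
  abstract
    fromℚᵘ-mono-< : ∀ {p q} → p ℚᵘ.< q → ℚ.fromℚᵘ p ℚ.< ℚ.fromℚᵘ q
    fromℚᵘ-mono-< {p} {q} p<q = ℚ.toℚᵘ-cancel-<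
      (ℚᵘ.<-respʳ-≃ {ℚ.toℚᵘ (ℚ.fromℚᵘ p)} (ℚᵘ.≃-sym (ℚ.toℚᵘ-fromℚᵘ q))
        (ℚᵘ.<-respˡ-≃ {q} (ℚᵘ.≃-sym (ℚ.toℚᵘ-fromℚᵘ p)) p<q))

    fromℚᵘ-mono-≤ : ∀ {p q} → p ℚᵘ.≤ q → ℚ.fromℚᵘ p ℚ.≤ ℚ.fromℚᵘ q
    fromℚᵘ-mono-≤ {p} {q} p≤q = ℚ.toℚᵘ-cancel-≤
      (ℚᵘ.≤-respʳ-≃ {ℚ.toℚᵘ (ℚ.fromℚᵘ p)} (ℚᵘ.≃-sym (ℚ.toℚᵘ-fromℚᵘ q))
        (ℚᵘ.≤-respˡ-≃ {q} (ℚᵘ.≃-sym (ℚ.toℚᵘ-fromℚᵘ p)) p≤q))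

    fromℚᵘ-+ : ∀ p q → ℚ.fromℚᵘ (p ℚᵘ.+ q) ≡ ℚ.fromℚᵘ p ℚ.+ ℚ.fromℚᵘ q
    fromℚᵘ-+ p q = ℚ.toℚᵘ-injective (ℚᵘ.≃-trans (ℚ.toℚᵘ-fromℚᵘ (p ℚᵘ.+ q)) (ℚᵘ.≃-sym
      (ℚᵘ.≃-trans (ℚ.toℚᵘ-homo-+ (ℚ.fromℚᵘ p) (ℚ.fromℚᵘ q))
                  (ℚᵘ.+-cong (ℚ.toℚᵘ-fromℚᵘ p) (ℚ.toℚᵘ-fromℚᵘ q)))))

    fromℚᵘ-* : ∀ p q → ℚ.fromℚᵘ (p ℚᵘ.* q) ≡ ℚ.fromℚᵘ p ℚ.* ℚ.fromℚᵘ q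
    fromℚᵘ-* p q = ℚ.toℚᵘ-injective (ℚᵘ.≃-trans (ℚ.toℚᵘ-fromℚᵘ (p ℚᵘ.* q)) (ℚᵘ.≃-sym
      (ℚᵘ.≃-trans (ℚ.toℚᵘ-homo-* (ℚ.fromℚᵘ p) (ℚ.fromℚᵘ q))
                  (ℚᵘ.*-cong (ℚ.toℚᵘ-fromℚᵘ p) (ℚ.toℚᵘ-fromℚᵘ q)))))

    archimedean : ∀ c ε → 0ℚ ℚ.< ε →
      ∃[ N ] (∀ n → N ℕ.≤ n → (+ c) ℚ./ suc n ℚ.< ε)
    archimedean c (mkℚ (+ suc p) d _) _ = c ℕ.* suc d , λ n n≥ →
      subst ((+ c) ℚ./ suc n ℚ.<_) (ℚ.↥p/↧p≡p _)
        (fromℚᵘ-mono-< {mkℚᵘ (+ c) n} {mkℚᵘ (+ suc p) d} (ℚᵘ.*<*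
          (subst₂ ℤ._<_ (ℤ.pos-* c (suc d)) (ℤ.pos-* (suc p) (suc n))
            (ℤ.+<+ (ℕ.<-≤-trans (ℕ.s≤s n≥) (ℕ.m≤n*m (suc n) (suc p)))))))
    archimedean c (mkℚ (+ zero) d _) (*<* (ℤ.+<+ ()))
    archimedean c (mkℚ ℤ.-[1+ p ] d _) (*<* ())

    <+⇒-< : ∀ a b {c} → a ℚ.< b ℚ.+ c → a ℚ.- b ℚ.< c
    <+⇒-< a b {c} p = subst (a ℚ.- b ℚ.<_) (cancel b c) (ℚ.+-monoˡ-< (ℚ.- b) p)
      where
      cancel : ∀ b c → (b ℚ.+ c) ℚ.- b ≡ c
      cancel = solve 2 (λ b c → (b :+ c) :- b := c) refl
        where open +-*-Solver

    ∣-∣<⁺ : ∀ a b {ε} → a ℚ.- b ℚ.< ε → b ℚ.- a ℚ.< ε → ℚ.∣ a ℚ.- b ∣ ℚ.< ε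
    ∣-∣<⁺ a b {ε} p q with ℚ.∣p∣≡p∨∣p∣≡-p (a ℚ.- b)
    ... | inj₁ eq = subst (ℚ._< ε) (sym eq) p
    ... | inj₂ eq = subst (ℚ._< ε) (sym (trans eq (flip a b))) q
      where
      flip : ∀ a b → ℚ.- (a ℚ.- b) ≡ b ℚ.- a
      flip = solve 2 (λ a b → :- (a :- b) := b :- a) refl
        where open +-*-Solver

    cross : ∀ k M N a b .{{_ : ℕ.NonZero M}} .{{_ : ℕ.NonZero N}} →
            a ℕ.* a ℕ.≤ k ℕ.* (M ℕ.* M) → k ℕ.* (N ℕ.* N) ℕ.< b ℕ.* b →
            a ℕ.* N ℕ.< b ℕ.* M
    cross k M N a b lo hi = ℕ.≰⇒> λ le → ℕ.<-irrefl refl (begin-strict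
        (b ℕ.* M) ℕ.* (b ℕ.* M)        ≤⟨ ℕ.*-mono-≤ le le ⟩
        (a ℕ.* N) ℕ.* (a ℕ.* N)        ≡⟨ interchange a N ⟩
        (a ℕ.* a) ℕ.* (N ℕ.* N)        ≤⟨ ℕ.*-monoˡ-≤ (N ℕ.* N) lo ⟩
        k ℕ.* (M ℕ.* M) ℕ.* (N ℕ.* N)  ≡⟨ swap k (M ℕ.* M) (N ℕ.* N) ⟩
        k ℕ.* (N ℕ.* N) ℕ.* (M ℕ.* M)  <⟨ ℕ.*-monoˡ-< (M ℕ.* M) {{ℕ.m*n≢0 M M}} hi ⟩
        (b ℕ.* b) ℕ.* (M ℕ.* M)        ≡⟨ interchange b M ⟨
        (b ℕ.* M) ℕ.* (b ℕ.* M)        ∎)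
      where
      open ℕ.≤-Reasoning
      interchange : ∀ x y → (x ℕ.* y) ℕ.* (x ℕ.* y) ≡ (x ℕ.* x) ℕ.* (y ℕ.* y)
      interchange = solve-∀
      swap : ∀ x y z → x ℕ.* y ℕ.* z ≡ x ℕ.* z ℕ.* y
      swap = solve-∀

    linear-bound : ∀ k N a → a ℕ.* a ℕ.≤ k ℕ.* (N ℕ.* N) → a ℕ.≤ k ℕ.* N
    linear-bound zero      N zero    lo = ℕ.z≤n
    linear-bound zero      N (suc a) ()
    linear-bound k@(suc _) N a       lo = ℕ.≮⇒≥ λ lt → ℕ.<-irrefl refl (begin-strict
        (k ℕ.* N) ℕ.* (k ℕ.* N)  <⟨ ℕ.*-mono-< lt lt ⟩
        a ℕ.* a                  ≤⟨ lo ⟩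
        k ℕ.* (N ℕ.* N)          ≤⟨ ℕ.m≤n*m (k ℕ.* (N ℕ.* N)) k ⟩
        k ℕ.* (k ℕ.* (N ℕ.* N))  ≡⟨ regroup k N ⟩
        (k ℕ.* N) ℕ.* (k ℕ.* N)  ∎)
      where
      open ℕ.≤-Reasoning
      regroup : ∀ x y → x ℕ.* (x ℕ.* (y ℕ.* y)) ≡ (x ℕ.* y) ℕ.* (x ℕ.* y)
      regroup = solve-∀

    quadratic-bound : ∀ k N a .{{_ : ℕ.NonZero N}} →
      a ℕ.* a ℕ.≤ k ℕ.* (N ℕ.* N) → k ℕ.* (N ℕ.* N) ℕ.< suc a ℕ.* suc a →
      k ℕ.* (N ℕ.* N) ℕ.< a ℕ.* a ℕ.+ suc (2 ℕ.* k) ℕ.* N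
    quadratic-bound k N a lo hi = begin-strict
        k ℕ.* (N ℕ.* N)                      <⟨ hi ⟩
        suc a ℕ.* suc a                      ≡⟨ expand a ⟩
        a ℕ.* a ℕ.+ (1 ℕ.+ 2 ℕ.* a)          ≤⟨ ℕ.+-monoʳ-≤ (a ℕ.* a)
          (ℕ.+-mono-≤ (ℕ.>-nonZero⁻¹ N) (ℕ.*-monoʳ-≤ 2 (linear-bound k N a lo))) ⟩
        a ℕ.* a ℕ.+ (N ℕ.+ 2 ℕ.* (k ℕ.* N))  ≡⟨ cong (a ℕ.* a ℕ.+_) (collect k N) ⟩
        a ℕ.* a ℕ.+ suc (2 ℕ.* k) ℕ.* N      ∎
      where
      open ℕ.≤-Reasoning
      expand : ∀ a → (1 ℕ.+ a) ℕ.* (1 ℕ.+ a) ≡ a ℕ.* a ℕ.+ (1 ℕ.+ 2 ℕ.* a)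
      expand = solve-∀
      collect : ∀ k N → N ℕ.+ 2 ℕ.* (k ℕ.* N) ≡ (1 ℕ.+ 2 ℕ.* k) ℕ.* N
      collect = solve-∀

    a/M<b/N+1/N : ∀ a b m n → a ℕ.* suc n ℕ.< suc b ℕ.* suc m →
                  (+ a) ℚ./ suc m ℚ.< (+ b) ℚ./ suc n ℚ.+ (+ 1) ℚ./ suc n
    a/M<b/N+1/N a b m n lt =
      subst ((+ a) ℚ./ suc m ℚ.<_) (fromℚᵘ-+ (mkℚᵘ (+ b) n) (mkℚᵘ (+ 1) n))
        (fromℚᵘ-mono-< {mkℚᵘ (+ a) m} {mkℚᵘ (+ b) n ℚᵘ.+ mkℚᵘ (+ 1) n} (ℚᵘ.*<*
          (subst₂ ℤ._<_ (ℤ.pos-* a (suc n ℕ.* suc n)) (lift (suc n) (suc m))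
            (ℤ.+<+ (lt′ (suc n) (suc m) lt)))))
      where
      lift : ∀ N M → + ((b ℕ.* N ℕ.+ 1 ℕ.* N) ℕ.* M) ≡
             (+ b ℤ.* + N ℤ.+ + 1 ℤ.* + N) ℤ.* + M
      lift N M = trans (ℤ.pos-* (b ℕ.* N ℕ.+ 1 ℕ.* N) M)
        (cong (ℤ._* + M) (cong₂ ℤ._+_ (ℤ.pos-* b N) (ℤ.pos-* 1 N)))
      regroup : ∀ x y z → (x ℕ.* y ℕ.+ 1 ℕ.* y) ℕ.* z ≡ ((1 ℕ.+ x) ℕ.* z) ℕ.* y
      regroup = solve-∀
      lt′ : ∀ N M .{{_ : ℕ.NonZero N}} → a ℕ.* N ℕ.< suc b ℕ.* M →
            a ℕ.* (N ℕ.* N) ℕ.< (b ℕ.* N ℕ.+ 1 ℕ.* N) ℕ.* M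
      lt′ N M lt = subst₂ ℕ._<_ (ℕ.*-assoc a N N) (sym (regroup b N M)) (ℕ.*-monoˡ-< N lt)

    a²/N²≤k : ∀ a k n → a ℕ.* a ℕ.≤ k ℕ.* (suc n ℕ.* suc n) →
              ((+ a) ℚ./ suc n) ℚ.* ((+ a) ℚ./ suc n) ℚ.≤ (+ k) ℚ./ 1
    a²/N²≤k a k n lo =
      subst (ℚ._≤ (+ k) ℚ./ 1) (fromℚᵘ-* (mkℚᵘ (+ a) n) (mkℚᵘ (+ a) n))
        (fromℚᵘ-mono-≤ {mkℚᵘ (+ a) n ℚᵘ.* mkℚᵘ (+ a) n} {mkℚᵘ (+ k) 0} (ℚᵘ.*≤*
          (subst₂ ℤ._≤_
            (trans (ℤ.pos-* a a) (sym (ℤ.*-identityʳ (+ a ℤ.* + a))))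
            (ℤ.pos-* k (suc n ℕ.* suc n))
            (ℤ.+≤+ lo))))

    k<a²/N²+c/N : ∀ a k c n → k ℕ.* (suc n ℕ.* suc n) ℕ.< a ℕ.* a ℕ.+ c ℕ.* suc n →
      (+ k) ℚ./ 1 ℚ.< ((+ a) ℚ./ suc n) ℚ.* ((+ a) ℚ./ suc n) ℚ.+ (+ c) ℚ./ suc n
    k<a²/N²+c/N a k c n lt = let s = mkℚᵘ (+ a) n ; e = mkℚᵘ (+ c) n in
      subst ((+ k) ℚ./ 1 ℚ.<_)
        (trans (fromℚᵘ-+ (s ℚᵘ.* s) e) (cong (ℚ._+ ℚ.fromℚᵘ e) (fromℚᵘ-* s s)))
        (fromℚᵘ-mono-< {mkℚᵘ (+ k) 0} {s ℚᵘ.* s ℚᵘ.+ e} (ℚᵘ.*<*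
          (subst₂ ℤ._<_ (ℤ.pos-* k (suc n ℕ.* suc n ℕ.* suc n)) (lift (suc n))
            (ℤ.+<+ (lt′ (suc n) lt)))))
      where
      lift : ∀ N → + (a ℕ.* a ℕ.* N ℕ.+ c ℕ.* (N ℕ.* N)) ≡
             (+ a ℤ.* + a ℤ.* + N ℤ.+ + c ℤ.* + (N ℕ.* N)) ℤ.* + 1
      lift N = trans
        (cong₂ ℤ._+_
          (trans (ℤ.pos-* (a ℕ.* a) N) (cong (ℤ._* + N) (ℤ.pos-* a a)))
          (ℤ.pos-* c (N ℕ.* N)))
        (sym (ℤ.*-identityʳ _))
      regroup : ∀ x y c → (x ℕ.+ c ℕ.* y) ℕ.* y ≡ x ℕ.* y ℕ.+ c ℕ.* (y ℕ.* y)
      regroup = solve-∀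
      lt′ : ∀ N .{{_ : ℕ.NonZero N}} → k ℕ.* (N ℕ.* N) ℕ.< a ℕ.* a ℕ.+ c ℕ.* N →
            k ℕ.* (N ℕ.* N ℕ.* N) ℕ.< a ℕ.* a ℕ.* N ℕ.+ c ℕ.* (N ℕ.* N)
      lt′ N lt = subst₂ ℕ._<_ (ℕ.*-assoc k (N ℕ.* N) N) (regroup (a ℕ.* a) N c)
                   (ℕ.*-monoˡ-< N lt)

    √-seq-step : ∀ k m n → √-seq k m ℚ.< √-seq k n ℚ.+ (+ 1) ℚ./ suc n
    √-seq-step k m n =
      let M² = k ℕ.* (suc m ℕ.* suc m)
          N² = k ℕ.* (suc n ℕ.* suc n)
      in a/M<b/N+1/N (isqrt M²) (isqrt N²) m n
           (cross k (suc m) (suc n) (isqrt M²) (suc (isqrt N²))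
             (proj₁ (isqrt-spec M²)) (proj₂ (isqrt-spec N²)))

    √-cauchy : ∀ k → Cauchy (√-seq k)
    √-cauchy k ε 0<ε =
      let N , p = archimedean 1 ε 0<ε
      in N , λ m n m≥ n≥ → ∣-∣<⁺ (√-seq k m) (√-seq k n)
           (ℚ.<-trans (<+⇒-< (√-seq k m) (√-seq k n) (√-seq-step k m n)) (p n n≥))
           (ℚ.<-trans (<+⇒-< (√-seq k n) (√-seq k m) (√-seq-step k n m)) (p m m≥))

    √-seq-square-≤ : ∀ k n → √-seq k n ℚ.* √-seq k n ℚ.≤ (+ k) ℚ./ 1
    √-seq-square-≤ k n =
      let N² = k ℕ.* (suc n ℕ.* suc n)
      in a²/N²≤k (isqrt N²) k n (proj₁ (isqrt-spec N²))

    √-seq-square-> : ∀ k n →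
      (+ k) ℚ./ 1 ℚ.< √-seq k n ℚ.* √-seq k n ℚ.+ (+ suc (2 ℕ.* k)) ℚ./ suc n
    √-seq-square-> k n =
      let N² = k ℕ.* (suc n ℕ.* suc n)
      in k<a²/N²+c/N (isqrt N²) k (suc (2 ℕ.* k)) n
           (quadratic-bound k (suc n) (isqrt N²)
             (proj₁ (isqrt-spec N²)) (proj₂ (isqrt-spec N²)))

√ : ℕ → ℝ
√ k = mkℝ (√-seq k) (√-cauchy k)

abstract
  √-nonNegative : ∀ k n → 0ℚ ℚ.≤ seq (√ k) n
  √-nonNegative k n = ℚ.nonNegative⁻¹ (√-seq k n)
    {{ℚ.normalize-nonNeg (isqrt (k ℕ.* (suc n ℕ.* suc n))) (suc n)}}

  √-square : ∀ k → √ k * √ k ≈ fromℤ (+ k)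
  √-square k ε 0<ε =
    let N , p = archimedean (suc (2 ℕ.* k)) ε 0<ε
    in N , λ n n≥ →
      let s² = √-seq k n ℚ.* √-seq k n
          K  = (+ k) ℚ./ 1
      in ∣-∣<⁺ s² K
           (<+⇒-< s² K (ℚ.≤-<-trans (√-seq-square-≤ k n)
             (subst (ℚ._< K ℚ.+ ε) (ℚ.+-identityʳ K) (ℚ.+-monoʳ-< K 0<ε))))
           (ℚ.<-trans (<+⇒-< K s² (√-seq-square-> k n)) (p n n≥))

Matrix : ℕ → Set
Matrix n = Fin n → Fin n → ℤ

∑ : ∀ {n} → Vector ℝ n → ℝ
∑ = foldr _+_ 0ℝ

infix 8 _·_

_·_ : ∀ {n} → Matrix n → Vector ℝ n → Vector ℝ n
(A · v) i = ∑ (λ j → fromℤ (A i j) * v j)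

-- Only real eigenvalues are considered: adjacency matrices are real
-- symmetric.  "v is nonzero" is read positively: some entry is apart
-- from zero.
IsEigenvalue : ∀ {n} → Matrix n → ℝ → Set
IsEigenvalue {n} A x =
  ∃[ v ] ((∃[ i ] v i # 0ℝ) × (∀ (i : Fin n) → (A · v) i ≈ x * v i))

record Graph : Set where
  field
    order       : ℕ
    adjacent    : Fin order → Fin order → Bool
    symmetric   : ∀ i j → adjacent i j ≡ adjacent j i
    irreflexive : ∀ i → adjacent i i ≡ false

  Adjacent : Fin order → Fin order → Set
  Adjacent i j = T (adjacent i j)

  degree : Fin order → ℕ
  degree i = ∣ tabulate (adjacent i) ∣

  Connected : Set
  Connected = ∀ i j → Star Adjacent i j

  Regular : ℕ → Set
  Regular k = ∀ i → degree i ≡ k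

record SignedGraph : Set where
  field
    ground : Graph

  open Graph ground public

  field
    sign           : ∀ i j → Adjacent i j → Sign
    sign-symmetric : ∀ i j (e : Adjacent i j) (e′ : Adjacent j i) →
                     sign i j e ≡ sign j i e′

  adjacencyMatrix : Matrix order
  adjacencyMatrix i j with T? (adjacent i j)
  ... | yes e = sign i j e ◃ 1
  ... | no  _ = 0ℤ

  HasEigenvalue : ℝ → Set
  HasEigenvalue = IsEigenvalue adjacencyMatrix

infix 4 _≅_

record _≅_ (G H : SignedGraph) : Set where
  private
    module G = SignedGraph G
    module H = SignedGraph H
  field
    bijection : Fin G.order ↔ Fin H.order

  open Inverse bijection public using (to)

  field
    preserves-adjacent : ∀ i j → G.adjacent i j ≡ H.adjacent (to i) (to j)
    preserves-sign     : ∀ i j (e : G.Adjacent i j) (e′ : H.Adjacent (to i) (to j)) →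
                         G.sign i j e ≡ H.sign (to i) (to j) e′

{-# OPTIONS --safe #-}

-- If S is the permutation matrix of a cyclic rotation of N ≥ 3 points, put
-- X = S + Sᵀ and Y = S - Sᵀ.  As S Sᵀ = Sᵀ S = I, the symmetric matrix with
-- block rows (X , Y) and (Yᵀ , - X) squares to 4 I, and it is the adjacency
-- matrix of a signed 4-regular graph.  If A is a signed adjacency matrix with
-- A² = k I, then the one with block rows (A , I) and (I , - A) squares to
-- (k + 1) I; this reaches every k ≥ 4, with orders growing with N.
-- From A² = k I an eigenvalue x satisfies x² = k, and conversely x e + A e is
-- an eigenvector for x = ± √ k, where e is a unit vector.

module Submission where

open import Defs
open import Algebra.Bundles using (CommutativeMonoid; CommutativeRing)
import Algebra.Properties.CommutativeMonoid.Sum as CommutativeMonoidSum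
import Algebra.Properties.Ring as RingProperties
import Algebra.Properties.Semiring.Sum as SemiringSum
open import Data.Bool.Base using (Bool; true; false; if_then_else_)
open import Data.Bool.Properties using (T?)
open import Data.Fin.Base using (Fin; zero; suc; _↑ˡ_; fromℕ; inject₁; join; punchIn; splitAt; toℕ)
open import Data.Fin.Induction using (<-weakInduction)
open import Data.Fin.Permutation using (Permutation′; permutation; ↔⇒≡)
import Data.Fin.Properties as Fin
open import Data.Fin.Relation.Unary.Top using (view; view-fromℕ; view-inject₁; ‵fromℕ; ‵inject₁)
open import Data.Fin.Subset using (∣_∣)
open import Data.Integer.Base as ℤ using (ℤ; +_; 0ℤ; 1ℤ)
import Data.Integer.Properties as ℤ
import Data.Integer.Solver as ℤ
open import Data.Nat.Base as ℕ using (ℕ; suc; _≤_; _⊔_; z≤n; s≤s)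
import Data.Nat.Properties as ℕ
open import Data.Product.Base using (_×_; _,_; ∃-syntax; Σ-syntax)
open import Data.Rational.Base as ℚ using (ℚ; 0ℚ; 1ℚ; ½)
import Data.Rational.Properties as ℚ
import Data.Rational.Solver as ℚ
open import Data.Rational.Unnormalised.Base as ℚᵘ using (mkℚᵘ)
import Data.Rational.Unnormalised.Properties as ℚᵘ
open import Data.Sum.Base as Sum using (_⊎_; inj₁; inj₂)
open import Data.Vec.Base using (tabulate)
open import Function.Base using (id; _∘_)
open import Function.Bundles using (_⇔_; mk⇔; Equivalence)
open import Level using (0ℓ)
open import Relation.Binary.Construct.Closure.ReflexiveTransitive as Star using (Star; _◅_; _◅◅_)
open import Relation.Binary.PropositionalEquality
import Relation.Binary.Reasoning.Setoid as SetoidReasoning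
open import Relation.Nullary.Decidable using (yes; no; does; isNo; fromWitnessFalse; toWitnessFalse)
open import Relation.Nullary.Negation using (¬_; contradiction)

-- Real numbers

Eventually : (ℕ → Set) → Set
Eventually P = ∃[ N ] (∀ n → N ≤ n → P n)

eventually-zip : ∀ {P Q R : ℕ → Set} → (∀ n → P n → Q n → R n) →
                 Eventually P → Eventually Q → Eventually R
eventually-zip f (M , p) (N , q) = M ⊔ N , λ n n≥ →
  f n (p n (ℕ.m⊔n≤o⇒m≤o M N n≥)) (q n (ℕ.m⊔n≤o⇒n≤o M N n≥))

eventually-map : ∀ {P Q : ℕ → Set} → (∀ n → P n → Q n) → Eventually P → Eventually Q
eventually-map f (N , p) = N , λ n n≥ → f n (p n n≥)

half : ∀ ε → 0ℚ ℚ.< ε → ∃[ δ ] (0ℚ ℚ.< δ × δ ℚ.+ δ ≡ ε)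
half ε 0<ε =
  ½ ℚ.* ε ,
  ℚ.positive⁻¹ _ {{ℚ.pos*pos⇒pos ½ ε {{ℚ.positive 0<ε}}}} ,
  trans (sym (ℚ.*-distribʳ-+ ε ½ ½)) (ℚ.*-identityˡ ε)

0<p*q : ∀ {p q} → 0ℚ ℚ.< p → 0ℚ ℚ.< q → 0ℚ ℚ.< p ℚ.* q
0<p*q {p} {q} 0<p 0<q =
  ℚ.positive⁻¹ _ {{ℚ.pos*pos⇒pos p {{ℚ.positive 0<p}} q {{ℚ.positive 0<q}}}}

∣p*q∣<r*s : ∀ p q {r s} → 0ℚ ℚ.< s → ℚ.∣ p ∣ ℚ.< r → ℚ.∣ q ∣ ℚ.< s → ℚ.∣ p ℚ.* q ∣ ℚ.< r ℚ.* s
∣p*q∣<r*s p q {r} {s} 0<s p<r q<s = begin-strict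
  ℚ.∣ p ℚ.* q ∣        ≡⟨ ℚ.∣p*q∣≡∣p∣*∣q∣ p q ⟩
  ℚ.∣ p ∣ ℚ.* ℚ.∣ q ∣  ≤⟨ ℚ.*-monoˡ-≤-nonNeg ℚ.∣ p ∣ {{ℚ.∣-∣-nonNeg p}} (ℚ.<⇒≤ q<s) ⟩
  ℚ.∣ p ∣ ℚ.* s        <⟨ ℚ.*-monoˡ-<-pos s {{ℚ.positive 0<s}} p<r ⟩
  r ℚ.* s              ∎
  where open ℚ.≤-Reasoning

∣p∣≤∣q∣+∣p-q∣ : ∀ p q → ℚ.∣ p ∣ ℚ.≤ ℚ.∣ q ∣ ℚ.+ ℚ.∣ p ℚ.- q ∣
∣p∣≤∣q∣+∣p-q∣ p q = subst (ℚ._≤ ℚ.∣ q ∣ ℚ.+ ℚ.∣ p ℚ.- q ∣) (cong ℚ.∣_∣ (cancel p q))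
  (ℚ.∣p+q∣≤∣p∣+∣q∣ q (p ℚ.- q))
  where
  cancel : ∀ p q → q ℚ.+ (p ℚ.- q) ≡ p
  cancel = solve 2 (λ p q → q :+ (p :- q) := p) refl
    where open ℚ.+-*-Solver

-- The order on rationals is decidable, so a choice can be made here. This is the only source of the
-- disjunctions between reals further on.
p+q<r+s⇒p<r⊎q<s : ∀ {p q r s} → p ℚ.+ q ℚ.< r ℚ.+ s → p ℚ.< r ⊎ q ℚ.< s
p+q<r+s⇒p<r⊎q<s {p} {q} {r} {s} lt with p ℚ.<? r
... | yes p<r = inj₁ p<r
... | no  p≮r = inj₂ (ℚ.≰⇒> λ s≤q → ℚ.<-irrefl refl
  (ℚ.<-≤-trans lt (ℚ.+-mono-≤ (ℚ.≮⇒≥ p≮r) s≤q)))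

-- `x ≈ y` unfolds to `Null` of the termwise difference, so the closure properties below apply
-- directly to equality of reals.
Null : (ℕ → ℚ) → Set
Null s = ∀ ε → 0ℚ ℚ.< ε → Eventually (λ n → ℚ.∣ s n ∣ ℚ.< ε)

Bounded : (ℕ → ℚ) → Set
Bounded s = ∃[ B ] (0ℚ ℚ.< B × Eventually (λ n → ℚ.∣ s n ∣ ℚ.< B))

-- The relation `x # 0ℝ` without its trailing subtraction of `0ℚ`; `#0⇒apart` and `apart⇒#0`
-- translate between the two.
Apart : (ℕ → ℚ) → Set
Apart s = ∃[ ε ] (0ℚ ℚ.< ε × Eventually (λ n → ε ℚ.< ℚ.∣ s n ∣))

null-resp : ∀ {s t} → (∀ n → s n ≡ t n) → Null s → Null t
null-resp s≗t s→0 ε 0<ε =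
  eventually-map (λ n → subst (λ q → ℚ.∣ q ∣ ℚ.< ε) (s≗t n)) (s→0 ε 0<ε)

null-0 : Null (λ _ → 0ℚ)
null-0 ε 0<ε = 0 , λ _ _ → 0<ε

null-neg : ∀ {s} → Null s → Null (λ n → ℚ.- s n)
null-neg {s} s→0 ε 0<ε =
  eventually-map (λ n → subst (ℚ._< ε) (sym (ℚ.∣-p∣≡∣p∣ (s n)))) (s→0 ε 0<ε)

null-+ : ∀ {s t} → Null s → Null t → Null (λ n → s n ℚ.+ t n)
null-+ {s} {t} s→0 t→0 ε 0<ε with half ε 0<ε
... | δ , 0<δ , refl = eventually-zip
  (λ n p q → ℚ.≤-<-trans (ℚ.∣p+q∣≤∣p∣+∣q∣ (s n) (t n)) (ℚ.+-mono-< p q))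
  (s→0 δ 0<δ) (t→0 δ 0<δ)

divide : ∀ B ε → 0ℚ ℚ.< B → 0ℚ ℚ.< ε → ∃[ δ ] (0ℚ ℚ.< δ × B ℚ.* δ ≡ ε)
divide B ε 0<B 0<ε =
  ℚ.1/ B ℚ.* ε ,
  0<p*q (ℚ.positive⁻¹ (ℚ.1/ B) {{ℚ.1/pos⇒pos B}}) 0<ε ,
  trans (sym (ℚ.*-assoc B (ℚ.1/ B) ε))
        (trans (cong (ℚ._* ε) (ℚ.*-inverseʳ B)) (ℚ.*-identityˡ ε))
  where
  instance
    B-positive : ℚ.Positive B
    B-positive = ℚ.positive 0<B
    B-nonZero : ℚ.NonZero B
    B-nonZero = ℚ.pos⇒nonZero B

null-* : ∀ {s t} → Bounded s → Null t → Null (λ n → s n ℚ.* t n)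
null-* {s} {t} (B , 0<B , s<B) t→0 ε 0<ε with divide B ε 0<B 0<ε
... | δ , 0<δ , refl =
  eventually-zip (λ n p q → ∣p*q∣<r*s (s n) (t n) 0<δ p q) s<B (t→0 δ 0<δ)

-- A factor eventually larger than `e` in absolute value lets `t` reach `ε` only if the product
-- reaches `e ℚ.* ε`. This cancels real factors without constructing inverses.
null-cancel : ∀ {s t} → Apart s → Null (λ n → s n ℚ.* t n) → Null t
null-cancel {s} {t} (e , 0<e , e<s) st→0 ε 0<ε = eventually-zip
  (λ n e<s st<eε → ℚ.≰⇒> λ ε≤t → ℚ.<-irrefl refl (begin-strict
    e ℚ.* ε                  ≤⟨ ℚ.*-monoˡ-≤-nonNeg e {{ℚ.pos⇒nonNeg e {{ℚ.positive 0<e}}}} ε≤t ⟩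
    e ℚ.* ℚ.∣ t n ∣          ≤⟨ ℚ.*-monoʳ-≤-nonNeg ℚ.∣ t n ∣ {{ℚ.∣-∣-nonNeg (t n)}} (ℚ.<⇒≤ e<s) ⟩
    ℚ.∣ s n ∣ ℚ.* ℚ.∣ t n ∣  ≡⟨ ℚ.∣p*q∣≡∣p∣*∣q∣ (s n) (t n) ⟨
    ℚ.∣ s n ℚ.* t n ∣        <⟨ st<eε ⟩
    e ℚ.* ε                  ∎))
  e<s (st→0 (e ℚ.* ε) (0<p*q 0<e 0<ε))
  where open ℚ.≤-Reasoning

-- A null difference eventually costs less than half of the bound, so the other half survives.
apart-resp : ∀ {s t} → Apart s → Null (λ n → s n ℚ.- t n) → Apart t
apart-resp {s} {t} (ε , 0<ε , ε<s) s-t→0 with half ε 0<ε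
... | δ , 0<δ , refl = δ , 0<δ , eventually-zip
  (λ n 2δ<s s-t<δ → ℚ.≰⇒> λ t≤δ → ℚ.<-irrefl refl (begin-strict
    δ ℚ.+ δ                              <⟨ 2δ<s ⟩
    ℚ.∣ s n ∣                            ≤⟨ ∣p∣≤∣q∣+∣p-q∣ (s n) (t n) ⟩
    ℚ.∣ t n ∣ ℚ.+ ℚ.∣ s n ℚ.- t n ∣      <⟨ ℚ.+-mono-≤-< t≤δ s-t<δ ⟩
    δ ℚ.+ δ                              ∎))
  ε<s (s-t→0 δ 0<δ)
  where open ℚ.≤-Reasoning

apart-*ʳ : ∀ {s t} → Bounded s → Apart (λ n → s n ℚ.* t n) → Apart t
apart-*ʳ {s} {t} (B , 0<B , s<B) (ε , 0<ε , ε<st) with divide B ε 0<B 0<ε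
... | δ , 0<δ , refl = δ , 0<δ , eventually-zip
  (λ n s<B Bδ<st → ℚ.≰⇒> λ t≤δ → ℚ.<-irrefl refl (begin-strict
    B ℚ.* δ                  <⟨ Bδ<st ⟩
    ℚ.∣ s n ℚ.* t n ∣        ≡⟨ ℚ.∣p*q∣≡∣p∣*∣q∣ (s n) (t n) ⟩
    ℚ.∣ s n ∣ ℚ.* ℚ.∣ t n ∣  ≤⟨ ℚ.*-monoˡ-≤-nonNeg ℚ.∣ s n ∣ {{ℚ.∣-∣-nonNeg (s n)}} t≤δ ⟩
    ℚ.∣ s n ∣ ℚ.* δ          ≤⟨ ℚ.*-monoʳ-≤-nonNeg δ {{ℚ.pos⇒nonNeg δ {{ℚ.positive 0<δ}}}} (ℚ.<⇒≤ s<B) ⟩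
    B ℚ.* δ                  ∎))
  s<B ε<st
  where open ℚ.≤-Reasoning

-- After the Cauchy index for `ε`, terms differ by less than `ε`, so one term beyond `ε ℚ.+ ε` keeps
-- all late terms beyond `ε`. Apartness thus follows from a single rational comparison.
large-term⇒apart : ∀ x ε → 0ℚ ℚ.< ε →
  ∃[ N ] (∀ m → N ≤ m → ε ℚ.+ ε ℚ.< ℚ.∣ seq x m ∣ → Apart (seq x))
large-term⇒apart x ε 0<ε = let N , x-close = cauchy x ε 0<ε in
  N , λ m m≥ 2ε<x → ε , 0<ε , N , λ n n≥ → ℚ.≰⇒> λ xₙ≤ε → ℚ.<-irrefl refl (begin-strict
    ε ℚ.+ ε                                       <⟨ 2ε<x ⟩
    ℚ.∣ seq x m ∣                                 ≤⟨ ∣p∣≤∣q∣+∣p-q∣ (seq x m) (seq x n) ⟩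
    ℚ.∣ seq x n ∣ ℚ.+ ℚ.∣ seq x m ℚ.- seq x n ∣   <⟨ ℚ.+-mono-≤-< xₙ≤ε (x-close m n m≥ n≥) ⟩
    ε ℚ.+ ε                                       ∎)
  where open ℚ.≤-Reasoning

-- The bound `ε` is four times `γ`. At one index past all three thresholds the two absolute values
-- add up to more than `ε`, so one of them exceeds `γ ℚ.+ γ`, and `large-term⇒apart` applies to that
-- summand.
apart-+⇒apart⊎apart : ∀ x y → Apart (seq (x + y)) → Apart (seq x) ⊎ Apart (seq y)
apart-+⇒apart⊎apart x y (ε , 0<ε , N , ε<x+y) with half ε 0<ε
... | δ , 0<δ , refl with half δ 0<δ
... | γ , 0<γ , refl = go (large-term⇒apart x γ 0<γ) (large-term⇒apart y γ 0<γ)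
  where
  go : ∃[ K ] (∀ m → K ≤ m → γ ℚ.+ γ ℚ.< ℚ.∣ seq x m ∣ → Apart (seq x)) →
       ∃[ L ] (∀ m → L ≤ m → γ ℚ.+ γ ℚ.< ℚ.∣ seq y m ∣ → Apart (seq y)) →
       Apart (seq x) ⊎ Apart (seq y)
  go (K , x-apart) (L , y-apart)
    with p+q<r+s⇒p<r⊎q<s (ℚ.<-≤-trans
           (ε<x+y m (ℕ.m≤m⊔n N (K ⊔ L))) (ℚ.∣p+q∣≤∣p∣+∣q∣ (seq x m) (seq y m)))
    where m = N ⊔ (K ⊔ L)
  ... | inj₁ 2γ<x = inj₁ (x-apart _ (ℕ.≤-trans (ℕ.m≤m⊔n K L) (ℕ.m≤n⊔m N (K ⊔ L))) 2γ<x)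
  ... | inj₂ 2γ<y = inj₂ (y-apart _ (ℕ.≤-trans (ℕ.m≤n⊔m K L) (ℕ.m≤n⊔m N (K ⊔ L))) 2γ<y)

bounded : ∀ x → Bounded (seq x)
bounded x = let N , x-close = cauchy x 1ℚ (ℚ.positive⁻¹ 1ℚ) in
  ℚ.∣ seq x N ∣ ℚ.+ 1ℚ ,
  ℚ.+-mono-≤-< (ℚ.0≤∣p∣ (seq x N)) (ℚ.positive⁻¹ 1ℚ) ,
  N , λ n n≥ → ℚ.≤-<-trans (∣p∣≤∣q∣+∣p-q∣ (seq x n) (seq x N))
                 (ℚ.+-monoʳ-< ℚ.∣ seq x N ∣ (x-close n N n≥ ℕ.≤-refl))

-- A record around _≈_, so that x and y can be inferred from a proof of x ≃ y.
infix 4 _≃_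
record _≃_ (x y : ℝ) : Set where
  constructor ≈⇒≃
  field ≃⇒≈ : x ≈ y
open _≃_

private
  module Rearrange where
    open ℚ.+-*-Solver

    self : ∀ a → 0ℚ ≡ a ℚ.- a
    self a = sym (ℚ.+-inverseʳ a)

    swap : ∀ a b → ℚ.- (a ℚ.- b) ≡ b ℚ.- a
    swap = solve 2 (λ a b → :- (a :- b) := b :- a) refl

    chain : ∀ a b c → (a ℚ.- b) ℚ.+ (b ℚ.- c) ≡ a ℚ.- c
    chain = solve 3 (λ a b c → (a :- b) :+ (b :- c) := a :- c) refl

    sums : ∀ a b c d → (a ℚ.- b) ℚ.+ (c ℚ.- d) ≡ (a ℚ.+ c) ℚ.- (b ℚ.+ d)
    sums = solve 4 (λ a b c d → (a :- b) :+ (c :- d) := (a :+ c) :- (b :+ d)) refl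

    products : ∀ a b c d →
      c ℚ.* (a ℚ.- b) ℚ.+ b ℚ.* (c ℚ.- d) ≡ (a ℚ.* c) ℚ.- (b ℚ.* d)
    products = solve 4 (λ a b c d →
      c :* (a :- b) :+ b :* (c :- d) := (a :* c) :- (b :* d)) refl

    negs : ∀ a b → ℚ.- (a ℚ.- b) ≡ (ℚ.- a) ℚ.- (ℚ.- b)
    negs = solve 2 (λ a b → :- (a :- b) := (:- a) :- (:- b)) refl

-- Lifts the termwise ring laws of the rationals to the reals.
≡⇒≃ : ∀ {x y} → (∀ n → seq x n ≡ seq y n) → x ≃ y
≡⇒≃ {x} {y} x≗y = ≈⇒≃ (null-resp
  (λ n → trans (Rearrange.self (seq x n)) (cong (λ q → seq x n ℚ.- q) (x≗y n))) null-0)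

-- The commutative ring of real numbers

ℝ-commutativeRing : CommutativeRing 0ℓ 0ℓ
ℝ-commutativeRing = record
  { Carrier = ℝ ; _≈_ = _≃_ ; _+_ = _+_ ; _*_ = _*_ ; -_ = -_ ; 0# = 0ℝ ; 1# = fromℤ (+ 1)
  ; isCommutativeRing = record
    { isRing = record
      { +-isAbelianGroup = record
        { isGroup = record
          { isMonoid = record
            { isSemigroup = record
              { isMagma = record
                { isEquivalence = record
                  { refl = ≡⇒≃ (λ _ → refl)
                  ; sym = λ {x} {y} (≈⇒≃ p) →
                      ≈⇒≃ (null-resp (λ n → Rearrange.swap (seq x n) (seq y n)) (null-neg p))
                  ; trans = λ {x} {y} {z} (≈⇒≃ p) (≈⇒≃ q) →
                      ≈⇒≃ (null-resp (λ n → Rearrange.chain (seq x n) (seq y n) (seq z n)) (null-+ p q))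
                  }
                ; ∙-cong = λ {x} {y} {z} {w} (≈⇒≃ p) (≈⇒≃ q) → ≈⇒≃ (null-resp
                    (λ n → Rearrange.sums (seq x n) (seq y n) (seq z n) (seq w n)) (null-+ p q))
                }
              ; assoc = λ x y z → ≡⇒≃ (λ n → ℚ.+-assoc (seq x n) (seq y n) (seq z n))
              }
            ; identity = (λ x → ≡⇒≃ (λ n → ℚ.+-identityˡ (seq x n))) ,
                         (λ x → ≡⇒≃ (λ n → ℚ.+-identityʳ (seq x n)))
            }
          ; inverse = (λ x → ≡⇒≃ (λ n → ℚ.+-inverseˡ (seq x n))) ,
                      (λ x → ≡⇒≃ (λ n → ℚ.+-inverseʳ (seq x n)))
          ; ⁻¹-cong = λ {x} {y} (≈⇒≃ p) →
              ≈⇒≃ (null-resp (λ n → Rearrange.negs (seq x n) (seq y n)) (null-neg p))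
          }
        ; comm = λ x y → ≡⇒≃ (λ n → ℚ.+-comm (seq x n) (seq y n))
        }
      -- The difference of the products is `z (x - y) + y (z - w)`: each null difference is
      -- multiplied by a bounded sequence.
      ; *-cong = λ {x} {y} {z} {w} (≈⇒≃ p) (≈⇒≃ q) → ≈⇒≃ (null-resp
          (λ n → Rearrange.products (seq x n) (seq y n) (seq z n) (seq w n))
          (null-+ (null-* (bounded z) p) (null-* (bounded y) q)))
      ; *-assoc = λ x y z → ≡⇒≃ (λ n → ℚ.*-assoc (seq x n) (seq y n) (seq z n))
      ; *-identity = (λ x → ≡⇒≃ (λ n → ℚ.*-identityˡ (seq x n))) ,
                     (λ x → ≡⇒≃ (λ n → ℚ.*-identityʳ (seq x n)))
      ; distrib = (λ x y z → ≡⇒≃ (λ n → ℚ.*-distribˡ-+ (seq x n) (seq y n) (seq z n))) ,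
                  (λ x y z → ≡⇒≃ (λ n → ℚ.*-distribʳ-+ (seq x n) (seq y n) (seq z n)))
      }
    ; *-comm = λ x y → ≡⇒≃ (λ n → ℚ.*-comm (seq x n) (seq y n))
    }
  }

module ℝᵣ = CommutativeRing ℝ-commutativeRing

-- The embedding of the integers

fromℚᵘ-homo-+ : ∀ p q → ℚ.fromℚᵘ (p ℚᵘ.+ q) ≡ ℚ.fromℚᵘ p ℚ.+ ℚ.fromℚᵘ q
fromℚᵘ-homo-+ p q = ℚ.toℚᵘ-injective (ℚᵘ.≃-trans (ℚ.toℚᵘ-fromℚᵘ (p ℚᵘ.+ q)) (ℚᵘ.≃-sym
  (ℚᵘ.≃-trans (ℚ.toℚᵘ-homo-+ (ℚ.fromℚᵘ p) (ℚ.fromℚᵘ q))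
              (ℚᵘ.+-cong (ℚ.toℚᵘ-fromℚᵘ p) (ℚ.toℚᵘ-fromℚᵘ q)))))

fromℚᵘ-homo-* : ∀ p q → ℚ.fromℚᵘ (p ℚᵘ.* q) ≡ ℚ.fromℚᵘ p ℚ.* ℚ.fromℚᵘ q
fromℚᵘ-homo-* p q = ℚ.toℚᵘ-injective (ℚᵘ.≃-trans (ℚ.toℚᵘ-fromℚᵘ (p ℚᵘ.* q)) (ℚᵘ.≃-sym
  (ℚᵘ.≃-trans (ℚ.toℚᵘ-homo-* (ℚ.fromℚᵘ p) (ℚ.fromℚᵘ q))
              (ℚᵘ.*-cong (ℚ.toℚᵘ-fromℚᵘ p) (ℚ.toℚᵘ-fromℚᵘ q)))))

fromℤ-homo-+ : ∀ a b → fromℤ (a ℤ.+ b) ≃ fromℤ a + fromℤ b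
fromℤ-homo-+ a b = ≡⇒≃ (λ _ → trans
  -- Unnormalised addition cross-multiplies by the denominators 1, which leaves the numerator
  -- `a ℤ.* 1ℤ ℤ.+ b ℤ.* 1ℤ`.
  (cong (λ c → ℚ.fromℚᵘ (mkℚᵘ c 0)) (sym (cong₂ ℤ._+_ (ℤ.*-identityʳ a) (ℤ.*-identityʳ b))))
  (fromℚᵘ-homo-+ (mkℚᵘ a 0) (mkℚᵘ b 0)))

fromℤ-homo-* : ∀ a b → fromℤ (a ℤ.* b) ≃ fromℤ a * fromℤ b
fromℤ-homo-* a b = ≡⇒≃ (λ _ → fromℚᵘ-homo-* (mkℚᵘ a 0) (mkℚᵘ b 0))

-- Apartness from zero and square roots

#0⇒apart : ∀ x → x # 0ℝ → Apart (seq x)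
#0⇒apart x (ε , 0<ε , p) =
  ε , 0<ε , eventually-map (λ n → subst (λ q → ε ℚ.< ℚ.∣ q ∣) (ℚ.+-identityʳ (seq x n))) p

apart⇒#0 : ∀ x → Apart (seq x) → x # 0ℝ
apart⇒#0 x (ε , 0<ε , p) =
  ε , 0<ε , eventually-map (λ n → subst (λ q → ε ℚ.< ℚ.∣ q ∣) (sym (ℚ.+-identityʳ (seq x n)))) p

#0-resp : ∀ {x y} → x ≃ y → x # 0ℝ → y # 0ℝ
#0-resp {x} {y} (≈⇒≃ p) x#0 = apart⇒#0 y (apart-resp (#0⇒apart x x#0) p)

*-cancelˡ-#0 : ∀ {x y z} → x # 0ℝ → x * y ≃ x * z → y ≃ z
*-cancelˡ-#0 {x} {y} {z} x#0 (≈⇒≃ p) = ≈⇒≃ (null-cancel (#0⇒apart x x#0)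
  (null-resp (λ n → factor (seq x n) (seq y n) (seq z n)) p))
  where
  factor : ∀ a b c → a ℚ.* b ℚ.- a ℚ.* c ≡ a ℚ.* (b ℚ.- c)
  factor = solve 3 (λ a b c → a :* b :- a :* c := a :* (b :- c)) refl
    where open ℚ.+-*-Solver

-- A vanishing product `(x + s) (x - s)` does not by itself tell constructively which factor
-- vanishes. But `x + s` and `s - x` add up to `s + s`, which is apart from zero; hence one of them
-- is apart from zero and cancels, leaving the other factor null.
sqrt-unique : ∀ {x s} → (s + s) # 0ℝ → x * x ≃ s * s → x ≃ s ⊎ x ≃ - s
sqrt-unique {x} {s} 2s#0 (≈⇒≃ p) = Sum.map
  (λ x+s#0 → ≈⇒≃ (null-cancel x+s#0 (null-resp (λ n → factor (seq x n) (seq s n)) p)))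
  (λ s-x#0 → ≈⇒≃ (null-cancel s-x#0 (null-resp (λ n → factor′ (seq x n) (seq s n)) (null-neg p))))
  (apart-+⇒apart⊎apart (x + s) (s + - x) x+s+s-x#0)
  where
  open ℚ.+-*-Solver
  double : ∀ a b → b ℚ.+ b ≡ (a ℚ.+ b) ℚ.+ (b ℚ.+ ℚ.- a)
  double = solve 2 (λ a b → b :+ b := (a :+ b) :+ (b :+ (:- a))) refl
  factor : ∀ a b → a ℚ.* a ℚ.- b ℚ.* b ≡ (a ℚ.+ b) ℚ.* (a ℚ.- b)
  factor = solve 2 (λ a b → a :* a :- b :* b := (a :+ b) :* (a :- b)) refl
  factor′ : ∀ a b → ℚ.- (a ℚ.* a ℚ.- b ℚ.* b) ≡ (b ℚ.+ ℚ.- a) ℚ.* (a ℚ.- (ℚ.- b))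
  factor′ = solve 2 (λ a b → (:- (a :* a :- b :* b)) := (b :+ (:- a)) :* (a :- (:- b))) refl
  x+s+s-x#0 : Apart (seq ((x + s) + (s + - x)))
  x+s+s-x#0 = apart-resp (#0⇒apart (s + s) 2s#0)
    (≃⇒≈ {s + s} {(x + s) + (s + - x)} (≡⇒≃ (λ n → double (seq x n) (seq s n))))

*-#0ʳ : ∀ x y → (x * y) # 0ℝ → y # 0ℝ
*-#0ʳ x y xy#0 = apart⇒#0 y (apart-*ʳ (bounded x) (#0⇒apart (x * y) xy#0))

fromℤ-#0 : ∀ k → fromℤ (+ ℕ.suc k) # 0ℝ
fromℤ-#0 k = apart⇒#0 (fromℤ (+ ℕ.suc k)) (apart (+ ℕ.suc k ℚ./ 1) (ℚ.normalize-pos (ℕ.suc k) 1))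
  where
  -- The value is generalised to a variable so that `δ ℚ.+ δ ≡ q` can be matched. Half of it serves
  -- as the bound because the inequality must be strict.
  apart : ∀ q → ℚ.Positive q → Apart (λ _ → q)
  apart q q-pos with half q (ℚ.positive⁻¹ q {{q-pos}})
  ... | δ , 0<δ , refl = δ , 0<δ , 0 , λ _ _ → ℚ.<-≤-trans
    (subst (ℚ._< δ ℚ.+ δ) (ℚ.+-identityʳ δ) (ℚ.+-monoʳ-< δ 0<δ))
    (ℚ.≤-reflexive (sym (ℚ.0≤p⇒∣p∣≡p (ℚ.<⇒≤ (ℚ.+-mono-< 0<δ 0<δ)))))

√*√≃ : ∀ k → √ k * √ k ≃ fromℤ (+ k)
√*√≃ k = ≈⇒≃ (√-square k)

-- Multiplying by `s` gives twice `suc k`, a positive integer; a factor of a product apart from zero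
-- is apart from zero.
√+√-#0 : ∀ k → (√ (ℕ.suc k) + √ (ℕ.suc k)) # 0ℝ
√+√-#0 k = *-#0ʳ s (s + s) (#0-resp
  (ℝᵣ.sym (begin
    s * (s + s)                              ≈⟨ ℝᵣ.distribˡ s s s ⟩
    s * s + s * s                            ≈⟨ ℝᵣ.+-cong (√*√≃ (ℕ.suc k)) (√*√≃ (ℕ.suc k)) ⟩
    fromℤ (+ ℕ.suc k) + fromℤ (+ ℕ.suc k)    ≈⟨ fromℤ-homo-+ (+ ℕ.suc k) (+ ℕ.suc k) ⟨
    fromℤ (+ (ℕ.suc k ℕ.+ ℕ.suc k))          ∎))
  (fromℤ-#0 (k ℕ.+ ℕ.suc k)))
  where
  s = √ (ℕ.suc k)
  open SetoidReasoning ℝᵣ.setoid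

-- Signed adjacency matrices with a scalar square

module _ {c ℓ} (M : CommutativeMonoid c ℓ) where
  open CommutativeMonoid M renaming (refl to ≈-refl; sym to ≈-sym; trans to ≈-trans; _≈_ to _≋_)
  open CommutativeMonoidSum M using (sum; sum-remove; sum-cong-≋; sum-replicate-zero)

  -- Stated for commutative monoids because it serves both integer sums against `δ` and real sums
  -- against a scalar matrix.
  sum-singleton : ∀ {n} (i : Fin n) (f : Fin n → Carrier) →
                  (∀ j → j ≢ i → f j ≋ ε) → sum f ≋ f i
  sum-singleton {suc n} i f f≋0 = ≈-trans (sum-remove {i = i} f)
    (≈-trans (∙-congˡ (≈-trans
      (sum-cong-≋ (λ j → f≋0 (punchIn i j) (Fin.punchInᵢ≢i i j))) (sum-replicate-zero n)))
    (identityʳ (f i)))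

  sum-splitAt : ∀ m {n} (f : Fin m ⊎ Fin n → Carrier) →
                sum (f ∘ splitAt m) ≋ sum (f ∘ inj₁) ∙ sum (f ∘ inj₂)
  sum-splitAt ℕ.zero  f = ≈-sym (identityˡ _)
  sum-splitAt (suc m) f = ≈-trans
    (∙-congˡ (sum-splitAt m (f ∘ Sum.map suc id)))
    (≈-sym (assoc _ _ _))

module ℤᵣ = CommutativeRing ℤ.+-*-commutativeRing
module ∑ℤ = SemiringSum ℤᵣ.semiring

open ∑ℤ using () renaming (sum to ∑ℤ)

δ : ∀ {n} → Matrix n
δ i j = if does (i Fin.≟ j) then 1ℤ else 0ℤ

δ-diagonal : ∀ {n} {i j : Fin n} → i ≡ j → δ i j ≡ 1ℤ
δ-diagonal {i = i} {j} i≡j with i Fin.≟ j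
... | yes _   = refl
... | no  i≢j = contradiction i≡j i≢j

δ-off : ∀ {n} {i j : Fin n} → i ≢ j → δ i j ≡ 0ℤ
δ-off {i = i} {j} i≢j with i Fin.≟ j
... | yes i≡j = contradiction i≡j i≢j
... | no  _   = refl

δ-map : ∀ {m n} {f : Fin m → Fin n} → (∀ {i j} → f i ≡ f j → i ≡ j) →
        ∀ i j → δ (f i) (f j) ≡ δ i j
δ-map {f = f} f-injective i j with i Fin.≟ j
... | yes i≡j = δ-diagonal (cong f i≡j)
... | no  i≢j = δ-off (i≢j ∘ f-injective)

δ-symmetric : ∀ {n} (i j : Fin n) → δ i j ≡ δ j i
δ-symmetric i j with i Fin.≟ j
... | yes i≡j = sym (δ-diagonal (sym i≡j))
... | no  i≢j = sym (δ-off (i≢j ∘ sym))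

∑-δˡ : ∀ {n} (i : Fin n) (f : Fin n → ℤ) → ∑ℤ (λ j → δ i j ℤ.* f j) ≡ f i
∑-δˡ i f = trans
  (sum-singleton ℤᵣ.+-commutativeMonoid i (λ j → δ i j ℤ.* f j)
    (λ j j≢i → cong (ℤ._* f j) (δ-off (j≢i ∘ sym))))
  (trans (cong (ℤ._* f i) (δ-diagonal {i = i} refl)) (ℤ.*-identityˡ (f i)))

∑-δʳ : ∀ {n} (i : Fin n) (f : Fin n → ℤ) → ∑ℤ (λ j → f j ℤ.* δ j i) ≡ f i
∑-δʳ i f = trans
  (∑ℤ.sum-cong-≗ (λ j → trans (ℤ.*-comm (f j) (δ j i)) (cong (ℤ._* f j) (δ-symmetric j i))))
  (∑-δˡ i f)

infixl 7 _∙_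
infixl 6 _⊕_
infix  8 ⊖_
infix  9 _ᵀ

_∙_ : ∀ {n} → Matrix n → Matrix n → Matrix n
(A ∙ B) i k = ∑ℤ (λ j → A i j ℤ.* B j k)

_⊕_ : ∀ {n} → Matrix n → Matrix n → Matrix n
(A ⊕ B) i j = A i j ℤ.+ B i j

⊖_ : ∀ {n} → Matrix n → Matrix n
(⊖ A) i j = ℤ.- A i j

_ᵀ : ∀ {n} → Matrix n → Matrix n
(A ᵀ) i j = A j i

record IsScalar {n} (c : ℤ) (A : Matrix n) : Set where
  field
    diagonal     : ∀ i → A i i ≡ c
    off-diagonal : ∀ {i j} → i ≢ j → A i j ≡ 0ℤ

module _ {n} (A : Matrix n) where
  -- `Small` confines entries to -1, 0 and 1; `Irreducible` is connectedness of the graph whose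
  -- edges are the nonzero entries.
  Symmetric Hollow Small Irreducible : Set
  Symmetric   = ∀ i j → A i j ≡ A j i
  Hollow      = ∀ i → A i i ≡ 0ℤ
  Small       = ∀ i j → ℤ.∣ A i j ∣ ≤ 1
  Irreducible = ∀ i j → Star (λ i j → A i j ≢ 0ℤ) i j

-- Regularity is contained in `square`: for a symmetric matrix with entries -1, 0 and 1, a diagonal
-- entry of the square counts the nonzero entries of its row.
record IsSignedAdjacency {n} (k : ℕ) (A : Matrix n) : Set where
  field
    symmetric   : Symmetric A
    hollow      : Hollow A
    small       : Small A
    irreducible : Irreducible A
    square      : IsScalar (+ k) (A ∙ A)

-- Block matrices with a scalar square

module _ {n} (X Y : Matrix n) where

  blockEntry : Fin n ⊎ Fin n → Fin n ⊎ Fin n → ℤ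
  blockEntry (inj₁ i) (inj₁ j) = X i j
  blockEntry (inj₁ i) (inj₂ j) = Y i j
  blockEntry (inj₂ i) (inj₁ j) = Y j i
  blockEntry (inj₂ i) (inj₂ j) = ℤ.- X i j

  block : Matrix (n ℕ.+ n)
  block i j = blockEntry (splitAt n i) (splitAt n j)

  module _ {k}
    (X-symmetric : Symmetric X) (X-hollow : Hollow X) (X-small : Small X)
    (X-irreducible : Irreducible X) (Y-small : Small Y)
    (Y-column : ∀ j → ∃[ i ] Y i j ≢ 0ℤ)
    -- These are the blocks of the square on and above the diagonal. The first says that `X` and `Y`
    -- commute; the block below the diagonal is its transpose.
    (upper-right : ∀ i j → (X ∙ Y ⊕ Y ∙ ⊖ X) i j ≡ 0ℤ)
    (upper : IsScalar (+ k) (X ∙ X ⊕ Y ∙ Y ᵀ)) (lower : IsScalar (+ k) (X ∙ X ⊕ Y ᵀ ∙ Y))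
    where

    private
      entry-symmetric : ∀ p q → blockEntry p q ≡ blockEntry q p
      entry-symmetric (inj₁ i) (inj₁ j) = X-symmetric i j
      entry-symmetric (inj₁ i) (inj₂ j) = refl
      entry-symmetric (inj₂ i) (inj₁ j) = refl
      entry-symmetric (inj₂ i) (inj₂ j) = cong ℤ.-_ (X-symmetric i j)

      entry-hollow : ∀ p → blockEntry p p ≡ 0ℤ
      entry-hollow (inj₁ i) = X-hollow i
      entry-hollow (inj₂ i) = cong ℤ.-_ (X-hollow i)

      entry-small : ∀ p q → ℤ.∣ blockEntry p q ∣ ≤ 1
      entry-small (inj₁ i) (inj₁ j) = X-small i j
      entry-small (inj₁ i) (inj₂ j) = Y-small i j
      entry-small (inj₂ i) (inj₁ j) = Y-small j i
      entry-small (inj₂ i) (inj₂ j) = subst (_≤ 1) (sym (ℤ.∣-i∣≡∣i∣ (X i j))) (X-small i j)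

      Path : Fin n ⊎ Fin n → Fin n ⊎ Fin n → Set
      Path = Star (λ p q → blockEntry p q ≢ 0ℤ)

      X-path : ∀ i j → Path (inj₁ i) (inj₁ j)
      X-path i j = Star.gmap inj₁ id (X-irreducible i j)

      -- Paths run through the first half, which `X` connects; `Y-column` gives every vertex of the
      -- second half a neighbour there.
      entry-path : ∀ p q → Path p q
      entry-path (inj₁ i) (inj₁ j) = X-path i j
      entry-path (inj₁ i) (inj₂ j) = let m , Yₘⱼ≢0 = Y-column j in X-path i m ◅◅ (Yₘⱼ≢0 ◅ Star.ε)
      entry-path (inj₂ i) (inj₁ j) = let m , Yₘᵢ≢0 = Y-column i in Yₘᵢ≢0 ◅ X-path m j
      entry-path (inj₂ i) (inj₂ j) =
        let l , Yₗᵢ≢0 = Y-column i ; m , Yₘⱼ≢0 = Y-column j in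
        Yₗᵢ≢0 ◅ X-path l m ◅◅ (Yₘⱼ≢0 ◅ Star.ε)

      entry-square : Fin n ⊎ Fin n → Fin n ⊎ Fin n → ℤ
      entry-square p q = ∑ℤ (λ j → blockEntry p (inj₁ j) ℤ.* blockEntry (inj₁ j) q) ℤ.+
                         ∑ℤ (λ j → blockEntry p (inj₂ j) ℤ.* blockEntry (inj₂ j) q)

      block-square : ∀ i j → (block ∙ block) i j ≡ entry-square (splitAt n i) (splitAt n j)
      block-square i j = sum-splitAt ℤᵣ.+-commutativeMonoid n
        (λ p → blockEntry (splitAt n i) p ℤ.* blockEntry p (splitAt n j))

      -- By computation this block is `Y ᵀ ∙ Y` plus the square of `⊖ X`; the signs cancel and the
      -- summands are exchanged.
      lower-right : ∀ i j → entry-square (inj₂ i) (inj₂ j) ≡ (X ∙ X ⊕ Y ᵀ ∙ Y) i j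
      lower-right i j = trans
        (cong (λ c → (Y ᵀ ∙ Y) i j ℤ.+ c) (∑ℤ.sum-cong-≗ (λ m → neg-*-neg (X i m) (X m j))))
        (ℤ.+-comm ((Y ᵀ ∙ Y) i j) ((X ∙ X) i j))
        where
        neg-*-neg : ∀ a b → ℤ.- a ℤ.* ℤ.- b ≡ a ℤ.* b
        neg-*-neg = solve 2 (λ a b → (:- a) :* (:- b) := a :* b) refl
          where open ℤ.+-*-Solver

      entry-square-symmetric : ∀ p q → entry-square p q ≡ entry-square q p
      entry-square-symmetric p q = cong₂ ℤ._+_
        (∑ℤ.sum-cong-≗ (λ m → flip (inj₁ m))) (∑ℤ.sum-cong-≗ (λ m → flip (inj₂ m)))
        where
        flip : ∀ r → blockEntry p r ℤ.* blockEntry r q ≡ blockEntry q r ℤ.* blockEntry r p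
        flip r = trans (ℤ.*-comm (blockEntry p r) (blockEntry r q))
                       (cong₂ ℤ._*_ (entry-symmetric r q) (entry-symmetric p r))

      entry-diagonal : ∀ p → entry-square p p ≡ + k
      entry-diagonal (inj₁ i) = IsScalar.diagonal upper i
      entry-diagonal (inj₂ i) = trans (lower-right i i) (IsScalar.diagonal lower i)

      entry-off-diagonal : ∀ p q → p ≢ q → entry-square p q ≡ 0ℤ
      entry-off-diagonal (inj₁ i) (inj₁ j) p≢q = IsScalar.off-diagonal upper (p≢q ∘ cong inj₁)
      entry-off-diagonal (inj₁ i) (inj₂ j) p≢q = upper-right i j
      -- The square of a symmetric matrix is symmetric, so this reduces to the upper right block.
      entry-off-diagonal (inj₂ i) (inj₁ j) p≢q =
        trans (entry-square-symmetric (inj₂ i) (inj₁ j)) (upper-right j i)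
      entry-off-diagonal (inj₂ i) (inj₂ j) p≢q =
        trans (lower-right i j) (IsScalar.off-diagonal lower (p≢q ∘ cong inj₂))

      splitAt-injective : ∀ {i j} → splitAt n {n} i ≡ splitAt n j → i ≡ j
      splitAt-injective {i} {j} eq =
        trans (sym (Fin.join-splitAt n n i)) (trans (cong (join n n) eq) (Fin.join-splitAt n n j))

      block-irreducible : Irreducible block
      block-irreducible i j =
        subst₂ (Star (λ i j → block i j ≢ 0ℤ)) (Fin.join-splitAt n n i) (Fin.join-splitAt n n j)
          (Star.gmap (join n n) (λ {p} {q} → subst₂ (λ p q → blockEntry p q ≢ 0ℤ)
            (sym (Fin.splitAt-join n n p)) (sym (Fin.splitAt-join n n q)))
            (entry-path (splitAt n i) (splitAt n j)))

    block-isSignedAdjacency : IsSignedAdjacency k block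
    block-isSignedAdjacency = record
      { symmetric   = λ i j → entry-symmetric (splitAt n i) (splitAt n j)
      ; hollow      = λ i → entry-hollow (splitAt n i)
      ; small       = λ i j → entry-small (splitAt n i) (splitAt n j)
      ; irreducible = block-irreducible
      ; square      = record
        { diagonal     = λ i → trans (block-square i i) (entry-diagonal (splitAt n i))
        ; off-diagonal = λ {i} {j} i≢j → trans (block-square i j)
            (entry-off-diagonal (splitAt n i) (splitAt n j) (i≢j ∘ splitAt-injective))
        }
      }

-- The identity matrix commutes with `A`, its product with its transpose adds 1 to the scalar, and
-- it joins each vertex to its own copy.
doubling : ∀ {n k} {A : Matrix n} → IsSignedAdjacency k A → IsSignedAdjacency (suc k) (block A δ)
doubling {n} {k} {A} A-adj = block-isSignedAdjacency A δ
  symmetric hollow small irreducible δ-small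
  (λ j → j , λ δ≡0 → contradiction (trans (sym (δ-diagonal {i = j} refl)) δ≡0) λ ())
  (λ i j → trans (cong₂ ℤ._+_ (∑-δʳ j (A i)) (∑-δˡ i (λ m → ℤ.- A m j))) (ℤ.+-inverseʳ (A i j)))
  (scalar (λ i j → trans (∑-δˡ i (λ m → δ j m)) (δ-symmetric j i)))
  (scalar (λ i j → trans (∑ℤ.sum-cong-≗ (λ m → cong (ℤ._* δ m j) (δ-symmetric m i))) (∑-δˡ i (λ m → δ m j))))
  where
  open IsSignedAdjacency A-adj

  δ-small : Small (δ {n})
  δ-small i j with i Fin.≟ j
  ... | yes _ = s≤s z≤n
  ... | no  _ = z≤n

  scalar : ∀ {B : Matrix n} → (∀ i j → B i j ≡ δ i j) → IsScalar (+ suc k) (A ∙ A ⊕ B)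
  scalar B≡δ = record
    { diagonal     = λ i → trans
        (cong₂ ℤ._+_ (IsScalar.diagonal square i) (trans (B≡δ i i) (δ-diagonal {i = i} refl)))
        (cong +_ (ℕ.+-comm k 1))
    ; off-diagonal = λ {i} {j} i≢j →
        cong₂ ℤ._+_ (IsScalar.off-diagonal square i≢j) (trans (B≡δ i j) (δ-off i≢j))
    }

-- The cyclic rotation and the 4-regular base case

prev : ∀ {n} → Fin (suc n) → Fin (suc n)
prev zero    = fromℕ _
prev (suc i) = inject₁ i

next : ∀ {n} → Fin (suc n) → Fin (suc n)
next i with view i
... | ‵fromℕ     = zero
... | ‵inject₁ j = suc j

prev-next : ∀ {n} (i : Fin (suc n)) → prev (next i) ≡ i
prev-next i with view i
... | ‵fromℕ     = refl
... | ‵inject₁ j = refl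

next-prev : ∀ {n} (i : Fin (suc n)) → next (prev i) ≡ i
next-prev {n} zero    rewrite view-fromℕ n   = refl
next-prev     (suc i) rewrite view-inject₁ i = refl

rotation : ∀ {n} → Permutation′ (suc n)
rotation = permutation prev next prev-next next-prev

prev-injective : ∀ {n} {i j : Fin (suc n)} → prev i ≡ prev j → i ≡ j
prev-injective {i = i} {j} eq = trans (sym (next-prev i)) (trans (cong next eq) (next-prev j))

prev-irreflexive : ∀ {n} (i : Fin (suc (suc n))) → prev i ≢ i
prev-irreflexive zero    ()
prev-irreflexive (suc i) eq =
  ℕ.1+n≢n (trans (cong toℕ (sym eq)) (Fin.toℕ-inject₁ i))

-- From index 2 on, `toℕ` drops by two; the first two indices wrap around. Three points are
-- essential: on two points `prev` is an involution, and `X` would have entries 2 while `Y` would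
-- vanish.
prev²-irreflexive : ∀ {n} (i : Fin (suc (suc (suc n)))) → prev (prev i) ≢ i
prev²-irreflexive zero          ()
prev²-irreflexive (suc zero)    ()
prev²-irreflexive (suc (suc i)) eq = ℕ.m+1+n≢n 1 {toℕ i}
  (trans (cong toℕ (sym eq)) (trans (Fin.toℕ-inject₁ (inject₁ i)) (Fin.toℕ-inject₁ i)))

module _ {n : ℕ} where

  private
    N : ℕ
    N = suc (suc (suc n))

    S : Matrix N
    S i j = δ (prev i) j

    S·Sᵀ : ∀ i k → (S ∙ S ᵀ) i k ≡ δ i k
    S·Sᵀ i k = trans (∑-δˡ (prev i) (δ (prev k)))
      (trans (δ-map prev-injective k i) (δ-symmetric k i))

    -- Reindexing the sum along the rotation turns `prev j` into `j`.
    Sᵀ·S : ∀ i k → (S ᵀ ∙ S) i k ≡ δ i k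
    Sᵀ·S i k = trans (sym (∑ℤ.sum-permute (λ j → δ j i ℤ.* δ j k) rotation))
      (trans (∑ℤ.sum-cong-≗ (λ j → cong (ℤ._* δ j k) (δ-symmetric j i))) (∑-δˡ i (λ j → δ j k)))

    X Y : Matrix N
    X i j = S i j ℤ.+ S j i
    Y i j = S i j ℤ.- S j i

    X-small : Small X
    X-small i j with prev i Fin.≟ j | prev j Fin.≟ i
    -- An entry 2 would need both ones in the same place, that is, a point fixed by `prev` applied
    -- twice.
    ... | yes refl | yes eq = contradiction eq (prev²-irreflexive i)
    ... | yes _    | no  _  = s≤s z≤n
    ... | no  _    | yes _  = s≤s z≤n
    ... | no  _    | no  _  = z≤n

    Y-small : Small Y
    Y-small i j with prev i Fin.≟ j | prev j Fin.≟ i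
    ... | yes _ | yes _ = z≤n
    ... | yes _ | no  _ = s≤s z≤n
    ... | no  _ | yes _ = s≤s z≤n
    ... | no  _ | no  _ = z≤n

    X-symmetric : Symmetric X
    X-symmetric i j = ℤ.+-comm (S i j) (S j i)

    X-prev : ∀ i → X i (prev i) ≢ 0ℤ
    X-prev i eq = contradiction (trans (sym (cong₂ ℤ._+_
      (δ-diagonal {i = prev i} refl) (δ-off (prev²-irreflexive i)))) eq) λ ()

    Y-prev : ∀ j → Y (prev j) j ≢ 0ℤ
    Y-prev j eq = contradiction (trans (sym (cong₂ ℤ._-_
      (δ-off (prev²-irreflexive j)) (δ-diagonal {i = prev j} refl))) eq) λ ()

    X-path-to-zero : ∀ i → Star (λ i j → X i j ≢ 0ℤ) i zero
    -- `prev (suc i)` computes to `inject₁ i`, for which the induction already has a path.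
    X-path-to-zero = <-weakInduction _ Star.ε (λ i path → X-prev (suc i) ◅ path)

    X-irreducible : Irreducible X
    X-irreducible i j = X-path-to-zero i ◅◅
      Star.reverse (λ {i} {j} → subst (_≢ 0ℤ) (X-symmetric i j)) (X-path-to-zero j)

    -- In each block of the square the terms `S ∙ S` and `S ᵀ ∙ S ᵀ` cancel. What remains combines
    -- `S ∙ S ᵀ` and `S ᵀ ∙ S`, both of which are the identity.
    ∑-combination : ∀ c d i k {h : Fin N → ℤ} →
      (∀ j → h j ≡ c ℤ.* (S i j ℤ.* S k j) ℤ.+ d ℤ.* (S j i ℤ.* S j k)) →
      ∑ℤ h ≡ (c ℤ.+ d) ℤ.* δ i k
    ∑-combination c d i k {h} h≗ = begin
      ∑ℤ h
        ≡⟨ ∑ℤ.sum-cong-≗ h≗ ⟩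
      ∑ℤ (λ j → c ℤ.* f j ℤ.+ d ℤ.* g j)
        ≡⟨ ∑ℤ.∑-distrib-+ (λ j → c ℤ.* f j) (λ j → d ℤ.* g j) ⟩
      ∑ℤ (λ j → c ℤ.* f j) ℤ.+ ∑ℤ (λ j → d ℤ.* g j)
        ≡⟨ cong₂ ℤ._+_ (∑ℤ.*-distribˡ-sum c f) (∑ℤ.*-distribˡ-sum d g) ⟨
      c ℤ.* (S ∙ S ᵀ) i k ℤ.+ d ℤ.* (S ᵀ ∙ S) i k
        ≡⟨ cong₂ (λ a b → c ℤ.* a ℤ.+ d ℤ.* b) (S·Sᵀ i k) (Sᵀ·S i k) ⟩
      c ℤ.* δ i k ℤ.+ d ℤ.* δ i k
        ≡⟨ ℤ.*-distribʳ-+ (δ i k) c d ⟨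
      (c ℤ.+ d) ℤ.* δ i k ∎
      where
      open ≡-Reasoning
      f g : Fin N → ℤ
      f j = S i j ℤ.* S k j
      g j = S j i ℤ.* S j k

    scalar : ∀ {A : Matrix N} → (∀ i j → A i j ≡ + 4 ℤ.* δ i j) → IsScalar (+ 4) A
    scalar A≡4δ = record
      { diagonal     = λ i → trans (A≡4δ i i)
          (cong (λ d → + 4 ℤ.* d) (δ-diagonal {i = i} refl))
      ; off-diagonal = λ {i} {j} i≢j → trans (A≡4δ i j)
          (cong (λ d → + 4 ℤ.* d) (δ-off i≢j))
      }

    upper : ∀ i k → (X ∙ X ⊕ Y ∙ Y ᵀ) i k ≡ + 4 ℤ.* δ i k
    upper i k = trans
      (sym (∑ℤ.∑-distrib-+ (λ j → X i j ℤ.* X j k) (λ j → Y i j ℤ.* Y k j)))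
      (∑-combination (+ 2) (+ 2) i k (λ j → identity (S i j) (S j i) (S j k) (S k j)))
      where
      identity : ∀ a b c d → (a ℤ.+ b) ℤ.* (c ℤ.+ d) ℤ.+ (a ℤ.- b) ℤ.* (d ℤ.- c) ≡
                 + 2 ℤ.* (a ℤ.* d) ℤ.+ + 2 ℤ.* (b ℤ.* c)
      identity = solve 4 (λ a b c d → (a :+ b) :* (c :+ d) :+ (a :- b) :* (d :- c) :=
                   con (+ 2) :* (a :* d) :+ con (+ 2) :* (b :* c)) refl
        where open ℤ.+-*-Solver

    lower : ∀ i k → (X ∙ X ⊕ Y ᵀ ∙ Y) i k ≡ + 4 ℤ.* δ i k
    lower i k = trans
      (sym (∑ℤ.∑-distrib-+ (λ j → X i j ℤ.* X j k) (λ j → Y j i ℤ.* Y j k)))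
      (∑-combination (+ 2) (+ 2) i k (λ j → identity (S i j) (S j i) (S j k) (S k j)))
      where
      identity : ∀ a b c d → (a ℤ.+ b) ℤ.* (c ℤ.+ d) ℤ.+ (b ℤ.- a) ℤ.* (c ℤ.- d) ≡
                 + 2 ℤ.* (a ℤ.* d) ℤ.+ + 2 ℤ.* (b ℤ.* c)
      identity = solve 4 (λ a b c d → (a :+ b) :* (c :+ d) :+ (b :- a) :* (c :- d) :=
                   con (+ 2) :* (a :* d) :+ con (+ 2) :* (b :* c)) refl
        where open ℤ.+-*-Solver

    upper-right : ∀ i k → (X ∙ Y ⊕ Y ∙ ⊖ X) i k ≡ 0ℤ
    upper-right i k = trans
      (sym (∑ℤ.∑-distrib-+ (λ j → X i j ℤ.* Y j k) (λ j → Y i j ℤ.* ℤ.- X j k)))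
      -- The coefficients add up to zero, so the resulting multiple of `δ` computes to `0ℤ`.
      (∑-combination (ℤ.- + 2) (+ 2) i k (λ j → identity (S i j) (S j i) (S j k) (S k j)))
      where
      identity : ∀ a b c d → (a ℤ.+ b) ℤ.* (c ℤ.- d) ℤ.+ (a ℤ.- b) ℤ.* ℤ.- (c ℤ.+ d) ≡
                 ℤ.- + 2 ℤ.* (a ℤ.* d) ℤ.+ + 2 ℤ.* (b ℤ.* c)
      identity = solve 4 (λ a b c d → (a :+ b) :* (c :- d) :+ (a :- b) :* (:- (c :+ d)) :=
                   con (ℤ.- + 2) :* (a :* d) :+ con (+ 2) :* (b :* c)) refl
        where open ℤ.+-*-Solver

  -- The ground graph is the cycle of length `N` with every vertex doubled: `X` and `Y` are both
  -- nonzero exactly at cyclic neighbours, so each copy of a point is joined to both copies of its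
  -- two neighbours.
  cycle : Matrix (N ℕ.+ N)
  cycle = block X Y

  cycle-isSignedAdjacency : IsSignedAdjacency 4 cycle
  cycle-isSignedAdjacency = block-isSignedAdjacency X Y
    X-symmetric (λ i → cong₂ ℤ._+_ (δ-off (prev-irreflexive i)) (δ-off (prev-irreflexive i)))
    X-small X-irreducible Y-small (λ j → prev j , Y-prev j)
    upper-right (scalar upper) (scalar lower)

-- Signed graphs from matrices

isNonzero : ℤ → Bool
isNonzero z = isNo (z ℤ.≟ 0ℤ)

sign◃1 : ∀ z → ℤ.∣ z ∣ ≤ 1 → z ≢ 0ℤ → ℤ.sign z ℤ.◃ 1 ≡ z
sign◃1 (+ 0)             _        z≢0 = contradiction refl z≢0
sign◃1 (+ 1)             _        _   = refl
sign◃1 (+ suc (suc _))   (s≤s ()) _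
sign◃1 ℤ.-[1+ 0 ]        _        _   = refl
sign◃1 ℤ.-[1+ suc _ ]    (s≤s ()) _

-- Turns a diagonal entry of the square into a count of neighbours.
square-small : ∀ z → ℤ.∣ z ∣ ≤ 1 → z ℤ.* z ≡ (if isNonzero z then 1ℤ else 0ℤ)
square-small (+ 0)           _ = refl
square-small (+ 1)           _ = refl
square-small (+ suc (suc _)) (s≤s ())
square-small ℤ.-[1+ 0 ]      _ = refl
square-small ℤ.-[1+ suc _ ]  (s≤s ())

∣tabulate∣ : ∀ {n} (b : Fin n → Bool) → + ∣ tabulate b ∣ ≡ ∑ℤ (λ j → if b j then 1ℤ else 0ℤ)
∣tabulate∣ {ℕ.zero} b = refl
∣tabulate∣ {suc n}  b with b zero
... | true  = cong ℤ.suc (∣tabulate∣ (b ∘ suc))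
... | false = trans (∣tabulate∣ (b ∘ suc)) (sym (ℤ.+-identityˡ _))

module _ {n k} {A : Matrix n} (A-adj : IsSignedAdjacency k A) where
  open IsSignedAdjacency A-adj

  signedGraph : SignedGraph
  signedGraph = record
    { ground = record
      { order       = n
      ; adjacent    = λ i j → isNonzero (A i j)
      ; symmetric   = λ i j → cong isNonzero (symmetric i j)
      ; irreflexive = λ i → cong isNonzero (hollow i)
      }
    ; sign           = λ i j _ → ℤ.sign (A i j)
    ; sign-symmetric = λ i j _ _ → cong ℤ.sign (symmetric i j)
    }

  open SignedGraph signedGraph using (Connected; Regular; adjacencyMatrix)

  signedGraph-connected : Connected
  signedGraph-connected i j = Star.map fromWitnessFalse (irreducible i j)

  -- By symmetry `A i j ℤ.* A j i` is the square of an entry, the indicator of adjacency; the sum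
  -- over `j` is both the degree and a diagonal entry of the square.
  signedGraph-regular : Regular k
  signedGraph-regular i = ℤ.+-injective (trans (∣tabulate∣ (λ j → isNonzero (A i j)))
    (trans (∑ℤ.sum-cong-≗ (λ j → sym (trans
             (cong (A i j ℤ.*_) (symmetric j i)) (square-small (A i j) (small i j)))))
           (IsScalar.diagonal square i)))

  adjacencyMatrix≡ : ∀ i j → adjacencyMatrix i j ≡ A i j
  adjacencyMatrix≡ i j with T? (isNonzero (A i j))
  ... | yes Aᵢⱼ≢0 = sign◃1 (A i j) (small i j) (toWitnessFalse Aᵢⱼ≢0)
  ... | no  Aᵢⱼ≡0 with A i j ℤ.≟ 0ℤ
  ...   | yes eq  = sym eq
  ...   | no  neq = contradiction _ Aᵢⱼ≡0

  adjacencyMatrix-square : IsScalar (+ k) (adjacencyMatrix ∙ adjacencyMatrix)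
  adjacencyMatrix-square = record
    { diagonal     = λ i → trans (same i i) (IsScalar.diagonal square i)
    ; off-diagonal = λ {i} {j} i≢j → trans (same i j) (IsScalar.off-diagonal square i≢j)
    }
    where
    same : ∀ i j → (adjacencyMatrix ∙ adjacencyMatrix) i j ≡ (A ∙ A) i j
    same i j = ∑ℤ.sum-cong-≗ (λ m → cong₂ ℤ._*_ (adjacencyMatrix≡ i m) (adjacencyMatrix≡ m j))

-- Eigenvalues

module ∑ℝ = SemiringSum ℝᵣ.semiring

fromℤ-∑ : ∀ {n} (f : Fin n → ℤ) → fromℤ (∑ℤ f) ≃ ∑ (fromℤ ∘ f)
fromℤ-∑ {ℕ.zero} f = ≡⇒≃ (λ _ → refl)
fromℤ-∑ {suc n}  f = ℝᵣ.trans (fromℤ-homo-+ (f zero) (∑ℤ (f ∘ suc)))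
                              (ℝᵣ.+-congˡ (fromℤ-∑ (f ∘ suc)))

module _ {n} (M : Matrix n) where
  open SetoidReasoning ℝᵣ.setoid

  ·-cong : ∀ {u v : Fin n → ℝ} → (∀ j → u j ≃ v j) → ∀ i → (M · u) i ≃ (M · v) i
  ·-cong u≃v i = ∑ℝ.sum-cong-≋ (λ j → ℝᵣ.*-congˡ (u≃v j))

  ·-homo-+ : ∀ (u v : Fin n → ℝ) i → (M · (λ j → u j + v j)) i ≃ (M · u) i + (M · v) i
  ·-homo-+ u v i = ℝᵣ.trans
    (∑ℝ.sum-cong-≋ (λ j → ℝᵣ.distribˡ (fromℤ (M i j)) (u j) (v j)))
    (∑ℝ.∑-distrib-+ (λ j → fromℤ (M i j) * u j) (λ j → fromℤ (M i j) * v j))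

  ·-homo-* : ∀ x (v : Fin n → ℝ) i → (M · (λ j → x * v j)) i ≃ x * (M · v) i
  ·-homo-* x v i = ℝᵣ.trans
    (∑ℝ.sum-cong-≋ (λ j → swap (fromℤ (M i j)) (v j)))
    (ℝᵣ.sym (∑ℝ.*-distribˡ-sum x (λ j → fromℤ (M i j) * v j)))
    where
    swap : ∀ a b → a * (x * b) ≃ x * (a * b)
    swap a b = begin
      a * (x * b)  ≈⟨ ℝᵣ.*-assoc a x b ⟨
      a * x * b    ≈⟨ ℝᵣ.*-congʳ (ℝᵣ.*-comm a x) ⟩
      x * a * b    ≈⟨ ℝᵣ.*-assoc x a b ⟩
      x * (a * b)  ∎

  scalar-· : ∀ {c} → IsScalar c M → ∀ (v : Fin n → ℝ) i → (M · v) i ≃ fromℤ c * v i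
  scalar-· {c} M≡c v i = ℝᵣ.trans
    (sum-singleton ℝᵣ.+-commutativeMonoid i (λ j → fromℤ (M i j) * v j)
      (λ j j≢i → ℝᵣ.trans
        (ℝᵣ.*-congʳ (ℝᵣ.reflexive (cong fromℤ (IsScalar.off-diagonal M≡c (j≢i ∘ sym)))))
        (ℝᵣ.zeroˡ (v j))))
    (ℝᵣ.*-congʳ (ℝᵣ.reflexive (cong fromℤ (IsScalar.diagonal M≡c i))))

·-∙ : ∀ {n} (A B : Matrix n) (v : Fin n → ℝ) i → (A · (B · v)) i ≃ ((A ∙ B) · v) i
·-∙ {n} A B v i = begin
  ∑ (λ j → a j * ∑ (λ l → b j l * v l))
    ≈⟨ ∑ℝ.sum-cong-≋ (λ j → ∑ℝ.*-distribˡ-sum (a j) (λ l → b j l * v l)) ⟩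
  ∑ (λ j → ∑ (λ l → a j * (b j l * v l)))
    ≈⟨ ∑ℝ.∑-comm (λ j l → a j * (b j l * v l)) ⟩
  ∑ (λ l → ∑ (λ j → a j * (b j l * v l)))
    ≈⟨ ∑ℝ.sum-cong-≋ (λ l → ∑ℝ.sum-cong-≋ (λ j → ℝᵣ.trans
         (ℝᵣ.sym (ℝᵣ.*-assoc (a j) (b j l) (v l)))
         (ℝᵣ.*-congʳ (ℝᵣ.sym (fromℤ-homo-* (A i j) (B j l)))))) ⟩
  ∑ (λ l → ∑ (λ j → fromℤ (A i j ℤ.* B j l) * v l))
    ≈⟨ ∑ℝ.sum-cong-≋ (λ l → ℝᵣ.trans
         (ℝᵣ.sym (∑ℝ.*-distribʳ-sum (v l) (λ j → fromℤ (A i j ℤ.* B j l))))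
         (ℝᵣ.*-congʳ (ℝᵣ.sym (fromℤ-∑ (λ j → A i j ℤ.* B j l))))) ⟩
  ∑ (λ l → fromℤ ((A ∙ B) i l) * v l) ∎
  where
  open SetoidReasoning ℝᵣ.setoid
  a : Fin n → ℝ
  a j = fromℤ (A i j)
  b : Fin n → Fin n → ℝ
  b j l = fromℤ (B j l)

module _ {n k} (M : Matrix n) (M² : IsScalar (+ k) (M ∙ M)) where
  open SetoidReasoning ℝᵣ.setoid

  M·M· : ∀ v i → (M · (M · v)) i ≃ fromℤ (+ k) * v i
  M·M· v i = ℝᵣ.trans (·-∙ M M v i) (scalar-· (M ∙ M) M² v i)

  -- Applying `M` twice to the eigenvector scales it by `x * x` and also by `k`; comparison at the
  -- entry apart from zero allows cancelling it.
  eigenvalue⇒square : ∀ {x} → IsEigenvalue M x → x * x ≃ fromℤ (+ k)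
  eigenvalue⇒square {x} (v , (i , vᵢ#0) , Mv≈xv) = *-cancelˡ-#0 vᵢ#0 (begin
    v i * (x * x)                ≈⟨ ℝᵣ.*-comm (v i) (x * x) ⟩
    x * x * v i                  ≈⟨ ℝᵣ.*-assoc x x (v i) ⟩
    x * (x * v i)                ≈⟨ ℝᵣ.*-congˡ (≈⇒≃ (Mv≈xv i)) ⟨
    x * (M · v) i                ≈⟨ ·-homo-* M x v i ⟨
    (M · (λ j → x * v j)) i      ≈⟨ ·-cong M (λ j → ≈⇒≃ (Mv≈xv j)) i ⟨
    (M · (M · v)) i              ≈⟨ M·M· v i ⟩
    fromℤ (+ k) * v i            ≈⟨ ℝᵣ.*-comm (fromℤ (+ k)) (v i) ⟩
    v i * fromℤ (+ k)            ∎)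

  -- For `v = x e + M e`, `M v` is `x M e + k e`, and replacing `k` by `x * x` gives `x v`. The zero
  -- diagonal makes entry `i` of `v` equal to `x`, so `v` is nonzero.
  square⇒eigenvalue : ∀ {x} i → M i i ≡ 0ℤ → x # 0ℝ → x * x ≃ fromℤ (+ k) → IsEigenvalue M x
  square⇒eigenvalue {x} i Mᵢᵢ≡0 x#0 x²≃k =
    v , (i , #0-resp (ℝᵣ.sym vᵢ≃x) x#0) , λ l → ≃⇒≈ (Mv≃xv l)
    where
    e v : Fin n → ℝ
    e j = fromℤ (δ j i)
    v j = x * e j + (M · e) j

    [M·e]ᵢ≃0 : (M · e) i ≃ 0ℝ
    [M·e]ᵢ≃0 = begin
      ∑ (λ j → fromℤ (M i j) * fromℤ (δ j i))  ≈⟨ ∑ℝ.sum-cong-≋ (λ j → fromℤ-homo-* (M i j) (δ j i)) ⟨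
      ∑ (λ j → fromℤ (M i j ℤ.* δ j i))        ≈⟨ fromℤ-∑ (λ j → M i j ℤ.* δ j i) ⟨
      fromℤ (∑ℤ (λ j → M i j ℤ.* δ j i))       ≈⟨ ℝᵣ.reflexive (cong fromℤ (trans (∑-δʳ i (M i)) Mᵢᵢ≡0)) ⟩
      fromℤ 0ℤ                                 ≈⟨ ≡⇒≃ (λ _ → refl) ⟩
      0ℝ                                       ∎

    vᵢ≃x : v i ≃ x
    vᵢ≃x = begin
      x * e i + (M · e) i     ≈⟨ ℝᵣ.+-cong (ℝᵣ.*-congˡ (ℝᵣ.reflexive (cong fromℤ (δ-diagonal {i = i} refl)))) [M·e]ᵢ≃0 ⟩
      x * fromℤ (+ 1) + 0ℝ    ≈⟨ ℝᵣ.+-identityʳ (x * fromℤ (+ 1)) ⟩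
      x * fromℤ (+ 1)         ≈⟨ ℝᵣ.*-identityʳ x ⟩
      x                       ∎

    Mv≃xv : ∀ l → (M · v) l ≃ x * v l
    Mv≃xv l = begin
      (M · v) l
        ≈⟨ ·-homo-+ M (λ j → x * e j) (M · e) l ⟩
      (M · (λ j → x * e j)) l + (M · (M · e)) l
        ≈⟨ ℝᵣ.+-cong (·-homo-* M x e l) (M·M· e l) ⟩
      x * (M · e) l + fromℤ (+ k) * e l
        ≈⟨ ℝᵣ.+-congˡ (ℝᵣ.trans (ℝᵣ.*-congʳ (ℝᵣ.sym x²≃k)) (ℝᵣ.*-assoc x x (e l))) ⟩
      x * (M · e) l + x * (x * e l)
        ≈⟨ ℝᵣ.+-comm (x * (M · e) l) (x * (x * e l)) ⟩
      x * (x * e l) + x * (M · e) l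
        ≈⟨ ℝᵣ.distribˡ x (x * e l) ((M · e) l) ⟨
      x * v l ∎

square⇔±√ : ∀ k x → x * x ≃ fromℤ (+ suc k) ⇔ (x ≈ √ (suc k) ⊎ x ≈ - √ (suc k))
square⇔±√ k x = mk⇔
  (λ x²≃k → Sum.map ≃⇒≈ ≃⇒≈
    (sqrt-unique (√+√-#0 k) (ℝᵣ.trans x²≃k (ℝᵣ.sym (√*√≃ (suc k))))))
  (Sum.[ (λ x≈√ → ℝᵣ.trans (ℝᵣ.*-cong (≈⇒≃ x≈√) (≈⇒≃ x≈√)) (√*√≃ (suc k)))
       , (λ x≈-√ → ℝᵣ.trans (ℝᵣ.*-cong (≈⇒≃ x≈-√) (≈⇒≃ x≈-√))
           (ℝᵣ.trans (ℝᵣ.trans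
             (ℝᵣ.sym (-‿distribˡ-* s (- s))) (ℝᵣ.trans (ℝᵣ.-‿cong (ℝᵣ.sym (-‿distribʳ-* s s))) (-‿involutive (s * s))))
             (√*√≃ (suc k)))) ])
  where
  open RingProperties ℝᵣ.ring using (-‿distribˡ-*; -‿distribʳ-*; -‿involutive)
  s = √ (suc k)

-- The argument in `Fin n` is the vertex carrying the unit vector; a graph of order 0 would have no
-- eigenvalue.
signedGraph-eigenvalues : ∀ {n k} {A : Matrix n} (A-adj : IsSignedAdjacency (suc k) A) → Fin n →
  ∀ x → SignedGraph.HasEigenvalue (signedGraph A-adj) x ⇔ (x ≈ √ (suc k) ⊎ x ≈ - √ (suc k))
signedGraph-eigenvalues {k = k} A-adj i x = mk⇔
  (λ e → Equivalence.to (square⇔±√ k x) (eigenvalue⇒square M M² e))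
  (λ x≈±√ → let x²≃k = Equivalence.from (square⇔±√ k x) x≈±√ in
    square⇒eigenvalue M M² i
      (trans (adjacencyMatrix≡ A-adj i i) (IsSignedAdjacency.hollow A-adj i))
      -- `x` is apart from zero because its square is the positive integer `suc k`.
      (*-#0ʳ x x (#0-resp (ℝᵣ.sym x²≃k) (fromℤ-#0 k))) x²≃k)
  where
  M : Matrix _
  M = SignedGraph.adjacencyMatrix (signedGraph A-adj)
  M² : IsScalar (+ suc k) (M ∙ M)
  M² = adjacencyMatrix-square A-adj

-- The infinite family for each degree

order : ℕ → ℕ → ℕ
order ℕ.zero  i = (3 ℕ.+ i) ℕ.+ (3 ℕ.+ i)
order (suc m) i = order m i ℕ.+ order m i

-- `m` counts doublings, each raising the degree by one from 4, and `i` fixes the length `3 + i` of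
-- the rotation, which is never below 3.
matrix : ∀ m i → Matrix (order m i)
matrix ℕ.zero  i = cycle
matrix (suc m) i = block (matrix m i) δ

matrix-isSignedAdjacency : ∀ m i → IsSignedAdjacency (4 ℕ.+ m) (matrix m i)
matrix-isSignedAdjacency ℕ.zero  i = cycle-isSignedAdjacency
matrix-isSignedAdjacency (suc m) i = doubling (matrix-isSignedAdjacency m i)

vertex : ∀ m i → Fin (order m i)
vertex ℕ.zero  i = zero
vertex (suc m) i = vertex m i ↑ˡ order m i

m+m-injective : ∀ {m n} → m ℕ.+ m ≡ n ℕ.+ n → m ≡ n
m+m-injective {m} {n} eq =
  trans (ℕ.n≡⌊n+n/2⌋ m) (trans (cong ℕ.⌊_/2⌋ eq) (sym (ℕ.n≡⌊n+n/2⌋ n)))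

order-injective : ∀ m {i j} → order m i ≡ order m j → i ≡ j
order-injective ℕ.zero  eq = ℕ.+-cancelˡ-≡ 3 _ _ (m+m-injective eq)
order-injective (suc m) eq = order-injective m (m+m-injective eq)

theorem3p10 : (k : ℕ) → 4 ≤ k →
    Σ[ G ∈ (ℕ → SignedGraph) ] ((∀ (i : ℕ) →
    SignedGraph.Connected (G i) ×
    SignedGraph.Regular (G i) k ×
    (∀ (x : ℝ) → SignedGraph.HasEigenvalue (G i) x ⇔ (x ≈ √ k ⊎ x ≈ - √ k)))
    × (∀ (i j : ℕ) → i ≢ j → ¬ (G i ≅ G j)))
-- Matching on the bound turns `k` into `4 ℕ.+ m`, so `m` doublings are made.
theorem3p10 k (s≤s (s≤s (s≤s (s≤s (z≤n {m}))))) =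
  (λ i → signedGraph (adj i)) ,
  (λ i → signedGraph-connected (adj i) , signedGraph-regular (adj i) ,
         signedGraph-eigenvalues (adj i) (vertex m i)) ,
  -- An isomorphism forces equal orders, and for fixed `m` the order determines `i`.
  (λ i j i≢j G≅H → i≢j (order-injective m (↔⇒≡ (_≅_.bijection G≅H))))
  where
  adj : ∀ i → IsSignedAdjacency (4 ℕ.+ m) (matrix m i)
  adj = matrix-isSignedAdjacency m
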